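{- Let $d\ge1$ be fixed. A nonzero normalized state $H$ with $N(H)\le n$ (at most $n$ active vertices) and a pivot class $(a,r)$ with $H_{a,r}>0$ has $O_d(n^d)$ aggregated transitions. Moreover, those transitions and their integer weights can be generated with polynomial overhead in $n$ per transition.
   Context: A normalized state is a finitely supported array $H=(H_{a,r})_{a\ge1,\,1\le r\le d}$ of nonnegative integers, and $N(H)=\sum_{a,r}aH_{a,r}$. $O_d$ means that the implied constant depends only on $d$. For $a\ge1$ let $P_a(x)=(1+x^2)^{\lfloor(a-1)/2\rfloor}(1+x)^{\varepsilon_a}$ with $\varepsilon_a=1$ for $a$ even and $0$ for $a$ odd, and $I_a(u)=[x^u]P_a(x)$. Given $H$ and $(a,r)$ with $H_{a,r}>0$, let $h_{b,s}=H_{b,s}-1$ if $(b,s)=(a,r)$ and $h_{b,s}=H_{b,s}$ otherwise. For $b\ge1$, $1\le s\le d$ let $g_{ab}=\gcd(a,b)$, $\alpha_{ab}=b/g_{ab}$, $\beta_{ab}=a/g_{ab}$ and $K_{a,r;b,s}=\min\{g_{ab},\lfloor r/\alpha_{ab}\rfloor,\lfloor s/\beta_{ab}\rfloor\}$. $\mathcal{A}(H,a,r,u)$ is the set of families $\nu=(\nu_{b,s,k})_{b\ge1,\,1\le s\le d,\,0\le k\le K_{a,r;b,s}}$ of nonnegative integers with $$\sum_{k}\nu_{b,s,k}=h_{b,s}\text{ for all }(b,s),\qquad u+\sum_{b,s,k}k\,\alpha_{ab}\,\nu_{b,s,k}=r.$$ An aggregated transition from $H$ (with pivot class $(a,r)$)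 is a pair $(u,\nu)$ with $0\le u\le r$ and $\nu\in\mathcal{A}(H,a,r,u)$. Its weight is the integer $I_a(u)\prod_{b,s}W_{b,s}(\nu)$, where $$W_{b,s}(\nu)=\frac{h_{b,s}!}{\prod_k\nu_{b,s,k}!}\prod_k\binom{g_{ab}}{k}^{\nu_{b,s,k}},$$ and it leads to the state $H^\nu$, where $H^\nu_{b,t}$ ($b\ge1$, $1\le t\le d$) is the sum of $\nu_{b,s,k}$ over all $(s,k)$ with $s-k\beta_{ab}=t$. These are the terms of the recurrence $\Phi(H)=\sum_{u=0}^{r}I_a(u)\sum_{\nu\in\mathcal{A}(H,a,r,u)}\bigl(\prod_{b,s}W_{b,s}(\nu)\bigr)\Phi(H^\nu)$. -}

module Defs where

open import Data.Bool using (if_then_else_)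
open import Data.List using (List; []; _∷_; map; foldr; filter; concatMap; upTo)
open import Data.List.Membership.Propositional using (_∈_)
open import Data.List.Relation.Unary.All using (All; []; _∷_; lookup)
open import Data.List.Relation.Unary.Unique.Propositional using (Unique)
open import Data.Nat using (ℕ; zero; suc; _+_; _*_; _∸_; _^_; _/_; _≤_; _<_; _⊓_; _≟_)
open import Data.Nat.Base using (_!)
open import Data.Nat.ListAction using (sum; product)
open import Data.Nat.Combinatorics using (_C_)
open import Data.Nat.Divisibility using (_∣?_)
open import Data.Nat.GCD using (gcd)
open import Data.Fin using (Fin)
open import Data.Product using (Σ; _×_; _,_; ∃; ∃-syntax; proj₁; proj₂)
open import Function.Bundles using (Inverse; _⇔_)
open import Level using (0ℓ)
open import Relation.Binary.Bundles using (Setoid)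
open import Relation.Binary.PropositionalEquality using (_≡_; refl; sym; trans; setoid)
open import Relation.Nullary using (¬_; does; ¬?; _×-dec_)

∑ ∏ : List ℕ → (ℕ → ℕ) → ℕ
∑ is f = sum (map f is)
∏ is f = product (map f is)

-- 1⋯ n = [1, …, n]  and  0⋯ n = [0, …, n]
1⋯ 0⋯ : ℕ → List ℕ
1⋯ n = map suc (upTo n)
0⋯ n = upTo (suc n)

-- Floor division, made total by the junk value m div 0 = 0; every divisor
-- used below is positive for indices in range.
_div_ : ℕ → ℕ → ℕ
m div zero  = 0
m div suc n = m / suc n

infixl 7 _div_

-- Polynomials as coefficient sequences: p u is [x^u] p.

Poly : Set
Poly = ℕ → ℕ

_⊛_ : Poly → Poly → Poly
(p ⊛ q) u = ∑ (0⋯ u) λ i → p i * q (u ∸ i)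

one 1+x 1+x² : Poly
one 0 = 1
one _ = 0
1+x 0 = 1
1+x 1 = 1
1+x _ = 0
1+x² 0 = 1
1+x² 2 = 1
1+x² _ = 0

_^ᵖ_ : Poly → ℕ → Poly
p ^ᵖ zero  = one
p ^ᵖ suc m = p ⊛ (p ^ᵖ m)

ε : ℕ → ℕ
ε a = if does (2 ∣? a) then 1 else 0

P : ℕ → Poly
P a = (1+x² ^ᵖ ((a ∸ 1) div 2)) ⊛ (1+x ^ᵖ ε a)

I : ℕ → ℕ → ℕ
I a u = P a u

-- The array (H_{a,r}), a ≥ 1, 1 ≤ r ≤ d, is extended by zero to all of ℕ × ℕ;
-- bound witnesses finiteness of the support and is otherwise arbitrary.
record State (d : ℕ) : Set where
  field
    entry   : ℕ → ℕ → ℕ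
    bound   : ℕ
    support : ∀ a r → ¬ (1 ≤ a × a ≤ bound × 1 ≤ r × r ≤ d) → entry a r ≡ 0

open State public

Nonzero : ∀ {d} → State d → Set
Nonzero H = ∃[ a ] ∃[ r ] 0 < entry H a r

N : ∀ {d} → State d → ℕ
N {d} H = ∑ (1⋯ (bound H)) λ a → ∑ (1⋯ d) λ r → a * entry H a r

α β : ℕ → ℕ → ℕ
α a b = b div gcd a b
β a b = a div gcd a b

K : (a r b s : ℕ) → ℕ
K a r b s = gcd a b ⊓ (r div α a b) ⊓ (s div β a b)

module _ {d : ℕ} (H : State d) (a r : ℕ) where

  h : ℕ → ℕ → ℕ
  h b s = if does ((b ≟ a) ×-dec (s ≟ r)) then entry H b s ∸ 1 else entry H b s

  -- ν ∈ 𝒜(H,a,r,u), again with ν extended by zero outside its index set.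
  -- Since h vanishes for b > bound H, so does ν, and the sum in total may
  -- stop at bound H.
  record 𝒜 (u : ℕ) (ν : ℕ → ℕ → ℕ → ℕ) : Set where
    field
      outside : ∀ b s k → ¬ (1 ≤ b × 1 ≤ s × s ≤ d × k ≤ K a r b s) → ν b s k ≡ 0
      rows    : ∀ b s → 1 ≤ b → 1 ≤ s → s ≤ d → ∑ (0⋯ (K a r b s)) (ν b s) ≡ h b s
      total   : u + ∑ (1⋯ (bound H)) (λ b → ∑ (1⋯ d) λ s →
                      ∑ (0⋯ (K a r b s)) λ k → k * α a b * ν b s k) ≡ r

  record Transition : Set where
    field
      u   : ℕ
      u≤r : u ≤ r
      ν   : ℕ → ℕ → ℕ → ℕ
      ν∈𝒜 : 𝒜 u ν

  open Transition

  transitions : Setoid 0ℓ 0ℓ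
  transitions = record
    { Carrier       = Transition
    ; _≈_           = λ τ σ → u τ ≡ u σ × (∀ b s k → ν τ b s k ≡ ν σ b s k)
    ; isEquivalence = record
      { refl  = refl , λ _ _ _ → refl
      ; sym   = λ (p , q) → sym p , λ b s k → sym (q b s k)
      ; trans = λ (p , q) (p′ , q′) → trans p p′ , λ b s k → trans (q b s k) (q′ b s k)
      }
    }

  W : (ν : ℕ → ℕ → ℕ → ℕ) → ℕ → ℕ → ℕ
  W ν b s = (h b s ! div ∏ (0⋯ (K a r b s)) (λ k → ν b s k !))
          * ∏ (0⋯ (K a r b s)) (λ k → (gcd a b C k) ^ ν b s k)

  -- The factors with b > bound H are 1, as h and ν vanish there.
  weight : Transition → ℕ
  weight τ = I a (u τ) * ∏ (1⋯ (bound H)) λ b → ∏ (1⋯ d) λ s → W (ν τ) b s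

HasCardinality : Setoid 0ℓ 0ℓ → ℕ → Set
HasCardinality S m = Inverse S (setoid (Fin m))

-- Model of computation: a first-order language of primitive recursive
-- programs over natural numbers, pairs and lists, with unit cost for each
-- evaluation step.  Numbers are unary (the only constructor is suc) and data
-- can be shared by pointers, so each step is a constant-time pointer
-- operation, a number exceeds those in the input by at most the cost, and
-- cost is polynomially related to Turing machine time.  A program is a finite
-- syntactic object; Agda functions cannot be embedded in it.

infixr 5 _⊗_

data Ty : Set where
  nat  : Ty
  _⊗_  : Ty → Ty → Ty
  list : Ty → Ty

⟦_⟧ : Ty → Set
⟦ nat ⟧    = ℕ
⟦ A ⊗ B ⟧  = ⟦ A ⟧ × ⟦ B ⟧
⟦ list A ⟧ = List ⟦ A ⟧

Ctx : Set
Ctx = List Ty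

Env : Ctx → Set
Env Γ = All ⟦_⟧ Γ

data Tm : Ctx → Ty → Set where
  var   : ∀ {Γ A} → A ∈ Γ → Tm Γ A
  bind  : ∀ {Γ A B} → Tm Γ A → Tm (A ∷ Γ) B → Tm Γ B
  call  : ∀ {Γ A B} → Tm (A ∷ []) B → Tm Γ A → Tm Γ B
  ze    : ∀ {Γ} → Tm Γ nat
  su    : ∀ {Γ} → Tm Γ nat → Tm Γ nat
  caseN : ∀ {Γ A} → Tm Γ nat → Tm Γ A → Tm (nat ∷ Γ) A → Tm Γ A
  recN  : ∀ {Γ A} → Tm Γ nat → Tm Γ A → Tm (A ∷ nat ∷ Γ) A → Tm Γ A
  pair  : ∀ {Γ A B} → Tm Γ A → Tm Γ B → Tm Γ (A ⊗ B)
  fst   : ∀ {Γ A B} → Tm Γ (A ⊗ B) → Tm Γ A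
  snd   : ∀ {Γ A B} → Tm Γ (A ⊗ B) → Tm Γ B
  nil   : ∀ {Γ A} → Tm Γ (list A)
  cons  : ∀ {Γ A} → Tm Γ A → Tm Γ (list A) → Tm Γ (list A)
  caseL : ∀ {Γ A B} → Tm Γ (list A) → Tm Γ B → Tm (A ∷ list A ∷ Γ) B → Tm Γ B
  foldL : ∀ {Γ A B} → Tm Γ (list A) → Tm Γ B → Tm (B ∷ A ∷ Γ) B → Tm Γ B

rec : {X : Set} → (X → ℕ → X) → X → ℕ → X
rec f z zero    = z
rec f z (suc n) = f (rec f z n) n

value : ∀ {Γ A} → Tm Γ A → Env Γ → ⟦ A ⟧
value (var x)       ρ = lookup ρ x
value (bind t t′)   ρ = value t′ (value t ρ ∷ ρ)
value (call f t)    ρ = value f (value t ρ ∷ [])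
value ze            ρ = zero
value (su t)        ρ = suc (value t ρ)
value (caseN t z s) ρ with value t ρ
... | zero  = value z ρ
... | suc n = value s (n ∷ ρ)
value (recN t z s)  ρ = rec (λ x n → value s (x ∷ n ∷ ρ)) (value z ρ) (value t ρ)
value (pair t t′)   ρ = value t ρ , value t′ ρ
value (fst t)       ρ = proj₁ (value t ρ)
value (snd t)       ρ = proj₂ (value t ρ)
value nil           ρ = []
value (cons t t′)   ρ = value t ρ ∷ value t′ ρ
value (caseL t z s) ρ with value t ρ
... | []     = value z ρ
... | x ∷ xs = value s (x ∷ xs ∷ ρ)
value (foldL t z s) ρ = foldr (λ x y → value s (y ∷ x ∷ ρ)) (value z ρ) (value t ρ)

-- Total cost of the calls of a loop body, where f is the value of the body
-- and c its cost.
recCost : {X : Set} → (f : X → ℕ → X) (c : X → ℕ → ℕ) → X → ℕ → ℕ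
recCost f c z zero    = 0
recCost f c z (suc n) = recCost f c z n + suc (c (rec f z n) n)

foldCost : {X Y : Set} → (f : X → Y → Y) (c : X → Y → ℕ) → Y → List X → ℕ
foldCost f c z []       = 0
foldCost f c z (x ∷ xs) = foldCost f c z xs + suc (c x (foldr f z xs))

cost : ∀ {Γ A} → Tm Γ A → Env Γ → ℕ
cost (var x)       ρ = 1
cost (bind t t′)   ρ = suc (cost t ρ + cost t′ (value t ρ ∷ ρ))
cost (call f t)    ρ = suc (cost t ρ + cost f (value t ρ ∷ []))
cost ze            ρ = 1
cost (su t)        ρ = suc (cost t ρ)
cost (caseN t z s) ρ with value t ρ
... | zero  = suc (cost t ρ + cost z ρ)
... | suc n = suc (cost t ρ + cost s (n ∷ ρ))
cost (recN t z s)  ρ = suc (cost t ρ + cost z ρ +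
  recCost (λ x n → value s (x ∷ n ∷ ρ)) (λ x n → cost s (x ∷ n ∷ ρ)) (value z ρ) (value t ρ))
cost (pair t t′)   ρ = suc (cost t ρ + cost t′ ρ)
cost (fst t)       ρ = suc (cost t ρ)
cost (snd t)       ρ = suc (cost t ρ)
cost nil           ρ = 1
cost (cons t t′)   ρ = suc (cost t ρ + cost t′ ρ)
cost (caseL t z s) ρ with value t ρ
... | []     = suc (cost t ρ + cost z ρ)
... | x ∷ xs = suc (cost t ρ + cost s (x ∷ xs ∷ ρ))
cost (foldL t z s) ρ = suc (cost t ρ + cost z ρ +
  foldCost (λ x y → value s (y ∷ x ∷ ρ)) (λ x y → cost s (y ∷ x ∷ ρ)) (value z ρ) (value t ρ))

Program : Ty → Ty → Set
Program A B = Tm (A ∷ []) B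

run : ∀ {A B} → Program A B → ⟦ A ⟧ → ⟦ B ⟧
run p x = value p (x ∷ [])

time : ∀ {A B} → Program A B → ⟦ A ⟧ → ℕ
time p x = cost p (x ∷ [])

-- Input and output formats: states and families are given by the
-- lexicographically ordered lists of their nonzero entries, so the data do
-- not depend on bound.

StateTy InputTy TransitionTy OutputTy : Ty
StateTy      = list (nat ⊗ nat ⊗ nat)                 -- (b , s , H_{b,s})
InputTy      = StateTy ⊗ nat ⊗ nat                    -- (H , a , r)
TransitionTy = nat ⊗ list (nat ⊗ nat ⊗ nat ⊗ nat)     -- (u , [(b , s , k , ν_{b,s,k})])
OutputTy     = list (TransitionTy ⊗ nat)              -- [((u , ν) , weight)]

encodeState : ∀ {d} → State d → ⟦ StateTy ⟧
encodeState {d} H =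
  filter (λ (_ , _ , c) → ¬? (c ≟ 0))
    (concatMap (λ b → map (λ s → b , s , entry H b s) (1⋯ d)) (1⋯ (bound H)))

encodeTransition : ∀ {d} (H : State d) a r → Transition H a r → ⟦ TransitionTy ⟧
encodeTransition {d} H a r τ =
  u , filter (λ (_ , _ , _ , c) → ¬? (c ≟ 0))
        (concatMap (λ b → concatMap (λ s → map (λ k → b , s , k , ν b s k)
          (0⋯ (K a r b s))) (1⋯ d)) (1⋯ (bound H)))
  where open Transition τ

-- Transitions are equal in the sense of `transitions` exactly when their
-- encodings are, so out has one item per transition.
Generates : ∀ {d} (H : State d) (a r : ℕ) → ⟦ OutputTy ⟧ → Set
Generates H a r out =
  Unique out ×
  (∀ x → x ∈ out ⇔ (∃[ τ ] x ≡ (encodeTransition H a r τ , weight H a r τ)))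

{-# OPTIONS --safe #-}
module Submission where

-- Apart from the choice at k = 0, which is forced, a transition consists of u
-- and at most r ≤ d unit choices among the O_d(n) pairs (row, k), whence the
-- count.  As the number of transitions is at least 1, it is enough to
-- generate them in time polynomial in n.  The generator folds over the rows of
-- the state and keeps the list of partial transitions that fit the budget r.
-- After j rows there are at most (1 + j D)^d of them, D the number of words of
-- length d over {0, …, d}, and each has weight at most F^d, F a bound for the
-- factor of one row, since a row contributes a factor ≠ 1 only if it spends
-- budget.  So no value in the loop outgrows a polynomial.

open import Defs
open import Data.Bool using (if_then_else_)
import Data.Fin as Fin
open import Data.Fin using (Fin)
open import Data.List using (List; []; _∷_; [_]; _++_; map; filter; foldr; concatMap; length; lookup; replicate; downFrom; upTo; applyUpTo)
open import Data.List.Membership.DecPropositional using (_∈?_)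
open import Data.List.Membership.Propositional using (_∈_; _∉_; find)
open import Data.List.Membership.Propositional.Properties
open import Data.List.Properties
  using (foldr-cong; map-++; map-∘; map-upTo; map-concatMap; concatMap-cong; concatMap-++; filter-++; ++-assoc; ++-identityʳ;
         length-++; length-map; length-applyUpTo; applyUpTo-∷ʳ)
open import Data.List.Relation.Unary.All using (All; []; _∷_)
import Data.List.Relation.Unary.All as All
import Data.List.Relation.Unary.All.Properties as All
open import Data.List.Relation.Unary.AllPairs using ([]; _∷_)
open import Data.List.Relation.Unary.Any using (here; there; index)
open import Data.List.Relation.Unary.Any.Properties using (lookup-index)
open import Data.List.Relation.Unary.Unique.Propositional using (Unique)
import Data.List.Relation.Unary.Unique.Propositional.Properties as Unique
open import Data.Nat
open import Data.Nat.Combinatorics using (_C_; nCk+nC[k+1]≡[n+1]C[k+1]; k>n⇒nCk≡0; nCn≡1; nCk≡nC[n∸k]; k![n∸k]!∣n!)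
open import Data.Nat.Combinatorics.Specification using (nCk≡n!/k![n-k]!)
open import Data.Nat.Divisibility using (_∣_; _∣?_; divides; ∣⇒≤)
open import Data.Nat.DivMod using (m/n*n≤m; m/n≤m; m*n/n≡m; m/n*n≡m; /-monoˡ-≤; m≥n⇒m/n>0)
open import Data.Nat.GCD using (gcd; gcd[m,n]∣m; gcd[m,n]∣n; gcd-greatest; gcd[m,n]≢0; gcd[m,n]≤n)
open import Data.Nat.ListAction using (sum; product)
open import Data.Nat.ListAction.Properties using (sum-++; product-++)
open import Data.Nat.Properties
open import Data.Nat.Solver using (module +-*-Solver)
open import Data.Product using (Σ; _×_; _,_; ∃-syntax; proj₁; proj₂)
open import Data.Product.Properties using (≡-dec)
open import Data.Sum using (inj₁; inj₂)
open import Data.Unit using (⊤; tt)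
open import Function using (_∘_; id)
open import Function.Bundles using (_⇔_; mk⇔; Equivalence)
open import Level using (0ℓ)
open import Relation.Binary.Bundles using (Setoid)
open import Relation.Binary.PropositionalEquality using (_≡_; _≢_; refl; sym; trans; cong; cong₂; subst; module ≡-Reasoning)
open import Relation.Nullary

-- Polynomially bounded programs

-- A program is syntax, so its running time cannot be read off from the function it computes. `FP`
-- carries a program together with polynomial bounds for its time and for the size of its value.
-- Loops are the obstacle, since an accumulator may explode. All loops but one add to the
-- accumulator an amount that does not depend on it. The exception is the loop over the rows, where
-- one step may replace a partial transition by several; its bound comes from the budget, through
-- the potential `Φ` for the number of partial transitions and the invariant `Bounded` for their
-- size. Numbers being unary, values and not only digit counts must stay polynomial. This rules out
-- the factorials in `W`; they give way to products of binomial coefficients whose lower index is at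
-- most `d`. As `d` is fixed, whatever ranges over {0, ..., d} or over words is unrolled into the
-- program text. The bounds in `FP` speak of every input, encoding of a state or not; hence the
-- clipped budget in `start` and the positive factor `α′`.

-- f ≼ s: f is bounded by a polynomial in s.  One exponent is enough, since
-- constants and coefficients are absorbed by powers of the base, which is ≥ 2.
infix 4 _≼_

_≼_ : {X : Set} → (X → ℕ) → (X → ℕ) → Set
f ≼ s = ∃[ c ] ∀ x → f x ≤ (2 + s x) ^ c

m≤2^m : ∀ m → m ≤ 2 ^ m
m≤2^m zero    = z≤n
m≤2^m (suc m) = +-mono-≤ (m^n>0 2 m) (≤-trans (m≤2^m m) (m≤m+n _ 0))

module _ {X : Set} {s : X → ℕ} where

  ≼-weaken : {f g : X → ℕ} → (∀ x → f x ≤ g x) → g ≼ s → f ≼ s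
  ≼-weaken f≤g (c , g≤) = c , λ x → ≤-trans (f≤g x) (g≤ x)

  ≼-refl : s ≼ s
  ≼-refl = 1 , λ x → ≤-trans (m≤n+m (s x) 2) (≤-reflexive (sym (*-identityʳ _)))

  ≼-const : ∀ k → (λ (_ : X) → k) ≼ s
  ≼-const k = k , λ x → ≤-trans (m≤2^m k) (^-monoˡ-≤ k (m≤m+n 2 (s x)))

  ≼-+ : {f g : X → ℕ} → f ≼ s → g ≼ s → (λ x → f x + g x) ≼ s
  ≼-+ {f} {g} (c , f≤) (c′ , g≤) = suc (c ⊔ c′) , λ x → begin
    f x + g x                                ≤⟨ +-mono-≤
      (≤-trans (f≤ x) (^-monoʳ-≤ (2 + s x) (m≤m⊔n c c′)))
      (≤-trans (g≤ x) (^-monoʳ-≤ (2 + s x) (m≤n⊔m c c′))) ⟩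
    B x + B x                                ≤⟨ +-monoʳ-≤ (B x) (m≤m+n (B x) _) ⟩
    (2 + s x) ^ suc (c ⊔ c′)                 ∎
    where
    open ≤-Reasoning
    B : X → ℕ
    B x = (2 + s x) ^ (c ⊔ c′)

  ≼-suc : {f : X → ℕ} → f ≼ s → (λ x → suc (f x)) ≼ s
  ≼-suc = ≼-+ (≼-const 1)

  ≼-* : {f g : X → ℕ} → f ≼ s → g ≼ s → (λ x → f x * g x) ≼ s
  ≼-* (c , f≤) (c′ , g≤) = c + c′ , λ x →
    ≤-trans (*-mono-≤ (f≤ x) (g≤ x)) (≤-reflexive (sym (^-distribˡ-+-* (2 + s x) c c′)))

  ≼-^ : {f : X → ℕ} → f ≼ s → ∀ k → (λ x → f x ^ k) ≼ s
  ≼-^ f≼ zero    = ≼-const 1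
  ≼-^ f≼ (suc k) = ≼-* f≼ (≼-^ f≼ k)

  ≼-∑ : {K : Set} {f : K → X → ℕ} → (∀ k → f k ≼ s) → ∀ ks → (λ x → sum (map (λ k → f k x) ks)) ≼ s
  ≼-∑ f≼ []       = ≼-const 0
  ≼-∑ f≼ (k ∷ ks) = ≼-+ (f≼ k) (≼-∑ f≼ ks)

  ≼-trans : {f g : X → ℕ} → f ≼ g → g ≼ s → f ≼ s
  ≼-trans (c , f≤) g≼ = ≼-weaken f≤ (≼-^ (≼-+ (≼-const 2) g≼) c)

≼-∘ : {X Y : Set} {f s : Y → ℕ} (k : X → Y) → f ≼ s → (f ∘ k) ≼ (s ∘ k)
≼-∘ k (c , f≤) = c , λ x → f≤ (k x)

-- Numbers are unary, so a number counts with its value.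
size : ∀ A → ⟦ A ⟧ → ℕ
size nat      n        = n
size (A ⊗ B)  (x , y)  = size A x + size B y
size (list A) []       = 0
size (list A) (x ∷ xs) = suc (size A x + size (list A) xs)

length≤size : ∀ A (xs : ⟦ list A ⟧) → length xs ≤ size (list A) xs
length≤size A []       = z≤n
length≤size A (x ∷ xs) = s≤s (≤-trans (length≤size A xs) (m≤n+m _ _))

∈⇒size≤ : ∀ A {x} {xs : ⟦ list A ⟧} → x ∈ xs → size A x ≤ size (list A) xs
∈⇒size≤ A (here refl)  = ≤-trans (m≤m+n _ _) (n≤1+n _)
∈⇒size≤ A (there x∈xs) = ≤-trans (∈⇒size≤ A x∈xs) (≤-trans (m≤n+m _ _) (n≤1+n _))

size-++ : ∀ A (xs ys : ⟦ list A ⟧) → size (list A) (xs ++ ys) ≡ size (list A) xs + size (list A) ys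
size-++ A []       ys = refl
size-++ A (x ∷ xs) ys = cong suc (trans (cong (size A x +_) (size-++ A xs ys)) (sym (+-assoc (size A x) _ _)))

size-list≤ : ∀ A (xs : ⟦ list A ⟧) b → (∀ {x} → x ∈ xs → size A x ≤ b) →
             size (list A) xs ≤ length xs * suc b
size-list≤ A []       b h = z≤n
size-list≤ A (x ∷ xs) b h = +-mono-≤ (s≤s (h (here refl))) (size-list≤ A xs b (h ∘ there))

-- The size of the value is bounded along with the time, because the second program of a composite
-- runs in time polynomial in the size of the intermediate value.
record FP (A B : Ty) (f : ⟦ A ⟧ → ⟦ B ⟧) : Set where
  constructor fp
  field
    prog    : Program A B
    correct : ∀ x → run prog x ≡ f x
    time≼   : time prog ≼ size A
    size≼   : (size B ∘ f) ≼ size A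

open FP

FP-ext : ∀ {A B f g} → (∀ x → f x ≡ g x) → FP A B f → FP A B g
FP-ext {B = B} f≗g F = fp (prog F) (λ x → trans (correct F x) (f≗g x)) (time≼ F)
  (≼-weaken (λ x → ≤-reflexive (cong (size B) (sym (f≗g x)))) (size≼ F))

idᶠ : ∀ {A} → FP A A id
idᶠ = fp (var (here refl)) (λ _ → refl) (≼-const 1) ≼-refl

infixr 9 _∘ᶠ_

_∘ᶠ_ : ∀ {A B D g f} → FP B D g → FP A B f → FP A D (g ∘ f)
_∘ᶠ_ {g = g} {f} G F = fp (call (prog G) (prog F))
  (λ x → trans (cong (run (prog G)) (correct F x)) (correct G (f x)))
  (≼-weaken (λ x → ≤-reflexive (cong (λ y → suc (time (prog F) x + time (prog G) y)) (correct F x)))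
    (≼-suc (≼-+ (time≼ F) (≼-trans (≼-∘ f (time≼ G)) (size≼ F)))))
  (≼-trans (≼-∘ f (size≼ G)) (size≼ F))

⟨_,_⟩ᶠ : ∀ {A B D f g} → FP A B f → FP A D g → FP A (B ⊗ D) (λ x → f x , g x)
⟨ F , G ⟩ᶠ = fp (pair (prog F) (prog G)) (λ x → cong₂ _,_ (correct F x) (correct G x))
  (≼-suc (≼-+ (time≼ F) (time≼ G))) (≼-+ (size≼ F) (size≼ G))

fstᶠ : ∀ {A B D f} → FP A (B ⊗ D) f → FP A B (proj₁ ∘ f)
fstᶠ F = fp (fst (prog F)) (λ x → cong proj₁ (correct F x)) (≼-suc (time≼ F))
  (≼-weaken (λ x → m≤m+n _ _) (size≼ F))

sndᶠ : ∀ {A B D f} → FP A (B ⊗ D) f → FP A D (proj₂ ∘ f)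
sndᶠ F = fp (snd (prog F)) (λ x → cong proj₂ (correct F x)) (≼-suc (time≼ F))
  (≼-weaken (λ x → m≤n+m _ _) (size≼ F))

zeroᶠ : ∀ {A} → FP A nat (λ _ → 0)
zeroᶠ = fp ze (λ _ → refl) (≼-const 1) (≼-const 0)

sucᶠ : ∀ {A f} → FP A nat f → FP A nat (suc ∘ f)
sucᶠ F = fp (su (prog F)) (λ x → cong suc (correct F x)) (≼-suc (time≼ F)) (≼-suc (size≼ F))

constᶠ : ∀ {A} k → FP A nat (λ _ → k)
constᶠ zero    = zeroᶠ
constᶠ (suc k) = sucᶠ (constᶠ k)

[]ᶠ : ∀ {A B} → FP A (list B) (λ _ → [])
[]ᶠ = fp nil (λ _ → refl) (≼-const 1) (≼-const 0)

infixr 5 _∷ᶠ_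

_∷ᶠ_ : ∀ {A B f g} → FP A B f → FP A (list B) g → FP A (list B) (λ x → f x ∷ g x)
F ∷ᶠ G = fp (cons (prog F) (prog G)) (λ x → cong₂ _∷_ (correct F x) (correct G x))
  (≼-suc (≼-+ (time≼ F) (time≼ G))) (≼-suc (≼-+ (size≼ F) (size≼ G)))

ifz : {X : Set} → ℕ → X → X → X
ifz zero    x y = x
ifz (suc _) x y = y

ifzᶠ : ∀ {A B c f g} → FP A nat c → FP A B f → FP A B g → FP A B (λ x → ifz (c x) (f x) (g x))
ifzᶠ {A} {B} {c} {f} {g} T F G = fp p ok
  (≼-weaken cost≤ (≼-+ (≼-const 3) (≼-+ (time≼ T) (≼-+ (time≼ F) (time≼ G)))))
  (≼-weaken size≤ (≼-+ (size≼ F) (size≼ G)))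
  where
  -- In the successor branch the predecessor heads the environment, so `prog G`, which sees only its
  -- input, is called on the second variable.
  p = caseN (prog T) (prog F) (call (prog G) (var (there (here refl))))

  ok : ∀ x → run p x ≡ ifz (c x) (f x) (g x)
  ok x with run (prog T) x | correct T x
  ... | zero  | e rewrite sym e = correct F x
  ... | suc _ | e rewrite sym e = correct G x

  cost≤ : ∀ x → time p x ≤ 3 + (time (prog T) x + (time (prog F) x + time (prog G) x))
  cost≤ x with run (prog T) x
  ... | zero  = s≤s (≤-trans (+-monoʳ-≤ (time (prog T) x) (m≤m+n _ _)) (m≤n+m _ 2))
  ... | suc _ = s≤s (≤-trans (≤-reflexive (trans (+-suc t _) (cong suc (+-suc t _))))
                             (s≤s (s≤s (+-monoʳ-≤ t (m≤n+m _ (time (prog F) x))))))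
    where t = time (prog T) x

  size≤ : ∀ x → size B (ifz (c x) (f x) (g x)) ≤ size B (f x) + size B (g x)
  size≤ x with c x
  ... | zero  = m≤m+n _ _
  ... | suc _ = m≤n+m _ _

predᶠ : ∀ {A f} → FP A nat f → FP A nat (pred ∘ f)
predᶠ {A} {f} F = fp p ok (≼-weaken cost≤ (≼-+ (≼-const 2) (time≼ F))) (≼-weaken (λ x → pred[n]≤n) (size≼ F))
  where
  p = caseN (prog F) ze (var (here refl))

  ok : ∀ x → run p x ≡ pred (f x)
  ok x with run (prog F) x | correct F x
  ... | zero  | e rewrite sym e = refl
  ... | suc _ | e rewrite sym e = refl

  cost≤ : ∀ x → time p x ≤ 2 + time (prog F) x
  cost≤ x with run (prog F) x
  ... | zero  = s≤s (≤-reflexive (+-comm _ 1))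
  ... | suc _ = s≤s (≤-reflexive (+-comm _ 1))

-- The only use of `recN`; all later loops over numbers are folds over this list.
downFromᶠ : ∀ {A f} → FP A nat f → FP A (list nat) (downFrom ∘ f)
downFromᶠ {A} {f} F = D ∘ᶠ F
  where
  p : Program nat (list nat)
  p = recN (var (here refl)) nil (cons (var (there (here refl))) (var (here refl)))

  ok : ∀ m n → rec (λ x n → n ∷ x) [] n ≡ downFrom n
  ok m zero    = refl
  ok m (suc n) = cong (n ∷_) (ok m n)

  -- The 4 is 3 for `cons` of two variables and 1 for entering the body.
  recCost≡ : ∀ n → recCost {List ℕ} (λ x n → n ∷ x) (λ _ _ → 3) [] n ≡ n * 4
  recCost≡ zero    = refl
  recCost≡ (suc n) = trans (+-comm _ 4) (cong (4 +_) (recCost≡ n))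

  size≤ : ∀ n → size (list nat) (downFrom n) ≤ n * n
  size≤ zero    = z≤n
  size≤ (suc n) = s≤s (+-monoʳ-≤ n (≤-trans (size≤ n) (*-monoʳ-≤ n (n≤1+n n))))

  D : FP nat (list nat) downFrom
  D = fp p (λ n → ok n n)
    (≼-weaken (λ n → ≤-reflexive (cong (λ t → suc (2 + t)) (recCost≡ n)))
      (≼-+ (≼-const 3) (≼-* ≼-refl (≼-const 4))))
    (≼-weaken size≤ (≼-* ≼-refl ≼-refl))

-- The accumulator met at `x` is the fold of the suffix behind `x`, so the cost of the body has to
-- be bounded at these accumulators only.
foldCost≤ : ∀ {X Y : Set} (f : X → Y → Y) c z M xs →
            (∀ {x} zs ys → xs ≡ zs ++ x ∷ ys → c x (foldr f z ys) ≤ M) →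
            foldCost f c z xs ≤ length xs * suc M
foldCost≤ f c z M []       h = z≤n
foldCost≤ f c z M (x ∷ xs) h = ≤-trans
  (+-mono-≤ (foldCost≤ f c z M xs λ zs ys e → h (x ∷ zs) ys (cong (x ∷_) e)) (s≤s (h [] xs refl)))
  (≤-reflexive (+-comm (length xs * suc M) (suc M)))

-- Lets the cost of a loop be estimated along the accumulators of the specification instead of those
-- computed by the program.
foldCost-cong : ∀ {X Y : Set} {f f′ : X → Y → Y} {z z′} (c : X → Y → ℕ) →
                (∀ x y → f x y ≡ f′ x y) → z ≡ z′ → ∀ xs →
                foldCost f c z xs ≡ foldCost f′ c z′ xs
foldCost-cong c ff zz []       = refl
foldCost-cong c ff zz (x ∷ xs) =
  cong₂ (λ m y → m + suc (c x y)) (foldCost-cong c ff zz xs) (foldr-cong ff zz xs)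

module _ {E X B : Ty} {xs : ⟦ E ⟧ → List ⟦ X ⟧} {z : ⟦ E ⟧ → ⟦ B ⟧}
         {st : ⟦ B ⊗ (X ⊗ E) ⟧ → ⟦ B ⟧}
         (XS : FP E (list X) xs) (Z : FP E B z) (ST : FP (B ⊗ (X ⊗ E)) B st) where

  private
    F : ⟦ E ⟧ → ⟦ X ⟧ → ⟦ B ⟧ → ⟦ B ⟧
    F e x y = st (y , x , e)

    p : Program E B
    p = foldL (prog XS) (prog Z)
          (call (prog ST) (pair (var (here refl)) (pair (var (there (here refl))) (var (there (there (here refl)))))))

    c : ⟦ E ⟧ → ⟦ X ⟧ → ⟦ B ⟧ → ℕ
    -- One unit for the call and five for assembling its argument from three variables.
    c e x y = suc (5 + time (prog ST) (y , x , e))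

    ok : ∀ e → run p e ≡ foldr (F e) (z e) (xs e)
    ok e = trans (foldr-cong (λ x y → correct ST (y , x , e)) (correct Z e) (run (prog XS) e))
                 (cong (foldr (F e) (z e)) (correct XS e))

    cost≡ : ∀ e → time p e ≡
            suc (time (prog XS) e + time (prog Z) e + foldCost (F e) (c e) (z e) (xs e))
    cost≡ e = cong (λ t → suc (time (prog XS) e + time (prog Z) e + t))
      (trans (foldCost-cong (c e) (λ x y → correct ST (y , x , e)) (correct Z e) (run (prog XS) e))
             (cong (foldCost (F e) (c e) (z e)) (correct XS e)))

  -- A step that doubles its accumulator would make the fold exponential. As in Cobham's bounded
  -- recursion, a polynomial bound for all intermediate accumulators is therefore demanded.
  foldᶠ : ∀ {b} → b ≼ size E →
          (∀ e ys zs → xs e ≡ zs ++ ys → size B (foldr (λ x y → st (y , x , e)) (z e) ys) ≤ b e) →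
          FP E B (λ e → foldr (λ x y → st (y , x , e)) (z e) (xs e))
  foldᶠ {b} b≼ bounded = fp p ok
    (≼-weaken (λ e → ≤-trans (≤-reflexive (cost≡ e))
                (s≤s (+-monoʳ-≤ (time (prog XS) e + time (prog Z) e) (loop e))))
      (≼-suc (≼-+ (≼-+ (time≼ XS) (time≼ Z))
        (≼-* (≼-weaken (λ e → length≤size X (xs e)) (size≼ XS)) (≼-suc M≼)))))
    (≼-weaken (λ e → bounded e (xs e) [] refl) b≼)
    where
    k = proj₁ (time≼ ST)

    M : ⟦ E ⟧ → ℕ
    M e = 6 + (2 + (b e + (size (list X) (xs e) + size E e))) ^ k

    M≼ : M ≼ size E
    M≼ = ≼-+ (≼-const 6) (≼-^ (≼-+ (≼-const 2) (≼-+ b≼ (≼-+ (size≼ XS) ≼-refl))) k)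

    loop : ∀ e → foldCost (F e) (c e) (z e) (xs e) ≤ length (xs e) * suc (M e)
    loop e = foldCost≤ (F e) (c e) (z e) (M e) (xs e) λ {x} zs ys eq →
      +-monoʳ-≤ 6 (≤-trans (proj₂ (time≼ ST) _) (^-monoˡ-≤ k (+-monoʳ-≤ 2
        (+-mono-≤ (bounded e ys (zs ++ [ x ]) (trans eq (sym (++-assoc zs [ x ] ys))))
          (+-monoˡ-≤ (size E e) (∈⇒size≤ X (subst (x ∈_) (sym eq) (∈-++⁺ʳ zs (here refl)))))))))

  -- The increment depends on the list element and the environment but not on the accumulator, so
  -- the growth is at most the number of steps times a polynomial.
  foldAddᶠ : ∀ {inc} → inc ≼ size (X ⊗ E) →
             (∀ y x e → size B (st (y , x , e)) ≤ inc (x , e) + size B y) →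
             FP E B (λ e → foldr (λ x y → st (y , x , e)) (z e) (xs e))
  foldAddᶠ {inc} (k , inc≤) step = foldᶠ b≼ λ e ys zs eq →
    ≤-trans (go e ys λ x∈ → ∈⇒size≤ X (subst (_ ∈_) (sym eq) (∈-++⁺ʳ zs x∈)))
      (+-monoˡ-≤ (size B (z e)) (*-monoˡ-≤ (I′ e) (length≤ ys zs eq)))
    where
    I′ : ⟦ E ⟧ → ℕ
    I′ e = (2 + (size (list X) (xs e) + size E e)) ^ k

    b≼ : (λ e → size (list X) (xs e) * I′ e + size B (z e)) ≼ size E
    b≼ = ≼-+ (≼-* (size≼ XS) (≼-^ (≼-+ (≼-const 2) (≼-+ (size≼ XS) ≼-refl)) k)) (size≼ Z)

    length≤ : ∀ {e} ys zs → xs e ≡ zs ++ ys → length ys ≤ size (list X) (xs e)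
    length≤ {e} ys zs eq rewrite eq | size-++ X zs ys = ≤-trans (length≤size X ys) (m≤n+m _ _)

    go : ∀ e ys → (∀ {x} → x ∈ ys → size X x ≤ size (list X) (xs e)) →
         size B (foldr (F e) (z e) ys) ≤ length ys * I′ e + size B (z e)
    go e []       h = ≤-refl
    go e (x ∷ ys) h = begin
      size B (F e x y)                            ≤⟨ step y x e ⟩
      inc (x , e) + size B y                      ≤⟨ +-mono-≤ (≤-trans (inc≤ (x , e))
        (^-monoˡ-≤ k (+-monoʳ-≤ 2 (+-monoˡ-≤ (size E e) (h (here refl)))))) (go e ys (h ∘ there)) ⟩
      I′ e + (length ys * I′ e + size B (z e))    ≡⟨ +-assoc (I′ e) _ _ ⟨
      length (x ∷ ys) * I′ e + size B (z e)       ∎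
      where
      open ≤-Reasoning
      y = foldr (F e) (z e) ys

infixr 5 _++ᶠ_

_++ᶠ_ : ∀ {A B f g} → FP A (list B) f → FP A (list B) g → FP A (list B) (λ x → f x ++ g x)
_++ᶠ_ {f = f} {g} F G = FP-ext (λ x → foldr-∷ (f x) (g x))
  (foldAddᶠ F G (fstᶠ (sndᶠ idᶠ) ∷ᶠ fstᶠ idᶠ)
    {inc = λ (x , e) → suc (size _ x)} (≼-suc (≼-weaken (λ (x , e) → m≤m+n _ _) ≼-refl)) λ y x e → ≤-refl)
  where
  foldr-∷ : ∀ {X : Set} (xs ys : List X) → foldr _∷_ ys xs ≡ xs ++ ys
  foldr-∷ []       ys = refl
  foldr-∷ (x ∷ xs) ys = cong (x ∷_) (foldr-∷ xs ys)

concatMapᶠ : ∀ {E X B xs f} → FP E (list X) xs → FP (X ⊗ E) (list B) f →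
             FP E (list B) (λ e → concatMap (λ x → f (x , e)) (xs e))
concatMapᶠ {xs = xs} {f} XS F = FP-ext (λ e → foldr-++ (λ x → f (x , e)) (xs e))
  (foldAddᶠ XS []ᶠ (F ∘ᶠ sndᶠ idᶠ ++ᶠ fstᶠ idᶠ) (size≼ F)
    λ y x e → ≤-reflexive (size-++ _ (f (x , e)) y))
  where
  foldr-++ : ∀ {X Y : Set} (g : X → List Y) xs → foldr (λ x y → g x ++ y) [] xs ≡ concatMap g xs
  foldr-++ g []       = refl
  foldr-++ g (x ∷ xs) = cong (g x ++_) (foldr-++ g xs)

infixl 6 _+ᶠ_ _∸ᶠ_
infixl 7 _*ᶠ_

_+ᶠ_ : ∀ {A f g} → FP A nat f → FP A nat g → FP A nat (λ x → f x + g x)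
_+ᶠ_ {f = f} {g} F G = FP-ext (λ x → go (f x) (g x))
  (foldAddᶠ (downFromᶠ F) G (sucᶠ (fstᶠ idᶠ)) (≼-const 1) λ y x e → ≤-refl)
  where
  go : ∀ m n → foldr (λ _ y → suc y) n (downFrom m) ≡ m + n
  go zero    n = refl
  go (suc m) n = cong suc (go m n)

_*ᶠ_ : ∀ {A f g} → FP A nat f → FP A nat g → FP A nat (λ x → f x * g x)
_*ᶠ_ {f = f} {g} F G = FP-ext (λ x → go (f x) (g x))
  (foldAddᶠ (downFromᶠ F) zeroᶠ (G ∘ᶠ sndᶠ (sndᶠ idᶠ) +ᶠ fstᶠ idᶠ)
    (size≼ (G ∘ᶠ sndᶠ idᶠ)) λ y x e → ≤-refl)
  where
  go : ∀ m n → foldr (λ _ y → n + y) 0 (downFrom m) ≡ m * n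
  go zero    n = refl
  go (suc m) n = cong (n +_) (go m n)

_∸ᶠ_ : ∀ {A f g} → FP A nat f → FP A nat g → FP A nat (λ x → f x ∸ g x)
_∸ᶠ_ {f = f} {g} F G = FP-ext (λ x → go (f x) (g x))
  (foldAddᶠ (downFromᶠ G) F (predᶠ (fstᶠ idᶠ)) (≼-const 0) λ y x e → pred[n]≤n)
  where
  go : ∀ m n → foldr (λ _ y → pred y) m (downFrom n) ≡ m ∸ n
  go m zero    = refl
  go m (suc n) = trans (cong pred (go m n)) (pred[m∸n]≡m∸[1+n] m n)

_^ᶠ_ : ∀ {A f} → FP A nat f → ∀ k → FP A nat (λ x → f x ^ k)
F ^ᶠ zero  = constᶠ 1
F ^ᶠ suc k = F *ᶠ (F ^ᶠ k)

sumᶠ : ∀ {E X xs f} → FP E (list X) xs → FP (X ⊗ E) nat f →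
       FP E nat (λ e → sum (map (λ x → f (x , e)) (xs e)))
sumᶠ {xs = xs} {f} XS F = FP-ext (λ e → go (λ x → f (x , e)) (xs e))
  (foldAddᶠ XS zeroᶠ (F ∘ᶠ sndᶠ idᶠ +ᶠ fstᶠ idᶠ) (size≼ F) λ y x e → ≤-refl)
  where
  go : ∀ {X : Set} (g : X → ℕ) xs → foldr (λ x y → g x + y) 0 xs ≡ sum (map g xs)
  go g []       = refl
  go g (x ∷ xs) = cong (g x +_) (go g xs)

-- The index list lives outside the language: the program text contains one copy of `F k` per index,
-- in which `k` is a constant. This is how loops over words, over `k` and over `u` are unrolled.
⋃ᶠ : ∀ {A B} {K : Set} {f : K → ⟦ A ⟧ → ⟦ list B ⟧} → (∀ k → FP A (list B) (f k)) →
     ∀ ks → FP A (list B) (λ x → concatMap (λ k → f k x) ks)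
⋃ᶠ F []       = []ᶠ
⋃ᶠ F (k ∷ ks) = F k ++ᶠ ⋃ᶠ F ks

∑ᶠ : ∀ {A} {K : Set} {f : K → ⟦ A ⟧ → ℕ} → (∀ k → FP A nat (f k)) →
     ∀ ks → FP A nat (λ x → sum (map (λ k → f k x) ks))
∑ᶠ F []       = zeroᶠ
∑ᶠ F (k ∷ ks) = F k +ᶠ ∑ᶠ F ks

-- Arithmetic programs

-- Bounded search, where the value 0 of `t` means success; the result is 0 if nothing is found. With
-- unary numbers trying all candidates is polynomial, so quotient and gcd need no Euclidean
-- algorithm.
largest : (ℕ → ℕ) → ℕ → ℕ
largest t m = foldr (λ k y → ifz (t k) k y) 0 (downFrom (suc m))

largest-≡ : ∀ t m {k} → k ≤ m → t k ≡ 0 → (∀ j → j ≤ m → t j ≡ 0 → j ≤ k) → largest t m ≡ k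
largest-≡ t m {k} k≤m tk max with t m in tm
... | zero  = ≤-antisym (max m ≤-refl tm) k≤m
largest-≡ t zero    {zero} k≤m tk max | suc _ = refl
largest-≡ t (suc m) {k}    k≤m tk max | suc _ with m≤n⇒m<n∨m≡n k≤m
... | inj₁ (s≤s k≤m′) = largest-≡ t m k≤m′ tk λ j j≤m → max j (m≤n⇒m≤1+n j≤m)
... | inj₂ refl with () ← trans (sym tk) tm

largestᶠ : ∀ {E m t} → FP E nat m → FP (nat ⊗ E) nat t →
           FP E nat (λ e → largest (λ k → t (k , e)) (m e))
largestᶠ {t = t} M T = foldAddᶠ (downFromᶠ (sucᶠ M)) zeroᶠ
  (ifzᶠ (T ∘ᶠ sndᶠ idᶠ) (fstᶠ (sndᶠ idᶠ)) (fstᶠ idᶠ))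
  (size≼ (fstᶠ idᶠ)) (λ y x e → ifz≤ (t (x , e)) x y)
  where
  ifz≤ : ∀ c x y → ifz c x y ≤ x + y
  ifz≤ zero    x y = m≤m+n x y
  ifz≤ (suc _) x y = m≤n+m y x

-- Unlike _div_, quot m 0 = m.
quot : ℕ → ℕ → ℕ
quot m n = largest (λ q → q * n ∸ m) m

quot≡div : ∀ m {n} → 1 ≤ n → quot m n ≡ m div n
quot≡div m {suc n} _ = largest-≡ _ m (m/n≤m m (suc n)) (m≤n⇒m∸n≡0 (m/n*n≤m m (suc n)))
  λ j _ e → ≤-trans (≤-reflexive (sym (m*n/n≡m j (suc n)))) (/-monoˡ-≤ (suc n) (m∸n≡0⇒m≤n {j * suc n} {m} e))

quotᶠ : ∀ {A f g} → FP A nat f → FP A nat g → FP A nat (λ x → quot (f x) (g x))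
quotᶠ F G = largestᶠ F (fstᶠ idᶠ *ᶠ (G ∘ᶠ sndᶠ idᶠ) ∸ᶠ F ∘ᶠ sndᶠ idᶠ)

remainder : ℕ → ℕ → ℕ
remainder m n = m ∸ quot m n * n

∣⇒remainder≡0 : ∀ {m n} → 1 ≤ n → n ∣ m → remainder m n ≡ 0
∣⇒remainder≡0 {m} {suc n} n≥1 (divides q refl) = trans
  (cong (λ k → q * suc n ∸ k * suc n) (trans (quot≡div (q * suc n) n≥1) (m*n/n≡m q (suc n))))
  (n∸n≡0 (q * suc n))

remainder≡0⇒∣ : ∀ {m n} → 1 ≤ n → remainder m n ≡ 0 → n ∣ m
remainder≡0⇒∣ {m} {suc n} n≥1 e rewrite quot≡div m n≥1 =
  divides (m / suc n) (≤-antisym (m∸n≡0⇒m≤n e) (m/n*n≤m m (suc n)))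

remainderᶠ : ∀ {A f g} → FP A nat f → FP A nat g → FP A nat (λ x → remainder (f x) (g x))
remainderᶠ F G = F ∸ᶠ quotᶠ F G *ᶠ G

largestDivisor : ℕ → ℕ → ℕ
largestDivisor a b = largest (λ k → remainder a k + remainder b k) a

largestDivisor≡gcd : ∀ {a} b → 1 ≤ a → largestDivisor a b ≡ gcd a b
largestDivisor≡gcd {a} b a≥1 = largest-≡ (λ k → remainder a k + remainder b k) a
  (∣⇒≤ ⦃ >-nonZero a≥1 ⦄ (gcd[m,n]∣m a b))
  (cong₂ _+_ (∣⇒remainder≡0 g≥1 (gcd[m,n]∣m a b)) (∣⇒remainder≡0 g≥1 (gcd[m,n]∣n a b)))
  λ where
    zero    _ _ → z≤n
    (suc j) _ e → ∣⇒≤ ⦃ >-nonZero g≥1 ⦄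
      (gcd-greatest (remainder≡0⇒∣ {a} (s≤s z≤n) (m+n≡0⇒m≡0 (remainder a (suc j)) e))
                    (remainder≡0⇒∣ {b} (s≤s z≤n) (m+n≡0⇒n≡0 (remainder a (suc j)) e)))
  where
  g≥1 : 1 ≤ gcd a b
  g≥1 = n≢0⇒n>0 (gcd[m,n]≢0 a b (inj₁ (m<n⇒n≢0 a≥1)))

largestDivisorᶠ : ∀ {A f g} → FP A nat f → FP A nat g → FP A nat (λ x → largestDivisor (f x) (g x))
largestDivisorᶠ F G = largestᶠ F (remainderᶠ (F ∘ᶠ sndᶠ idᶠ) (fstᶠ idᶠ) +ᶠ remainderᶠ (G ∘ᶠ sndᶠ idᶠ) (fstᶠ idᶠ))

∑<ᶠ : ∀ {A f g} → FP nat nat g → FP A nat f → FP A nat (λ x → ∑ (downFrom (f x)) g)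
∑<ᶠ G F = sumᶠ (downFromᶠ F) (G ∘ᶠ fstᶠ idᶠ)

nC0≡1 : ∀ n → n C 0 ≡ 1
nC0≡1 n = trans (nCk≡nC[n∸k] {k = 0} {n} z≤n) (nCn≡1 n)

-- Recursion on `k` takes place outside the language and yields `k` nested sums by the hockey-stick
-- identity. With a variable lower index the value itself could be exponential.
Cᶠ : ∀ {A f} → FP A nat f → ∀ k → FP A nat (λ x → f x C k)
Cᶠ {f = f} F zero    = FP-ext (λ x → sym (nC0≡1 (f x))) (constᶠ 1)
Cᶠ {f = f} F (suc k) = FP-ext (λ x → hockey (f x)) (∑<ᶠ (Cᶠ idᶠ k) F)
  where
  hockey : ∀ n → ∑ (downFrom n) (_C k) ≡ n C suc k
  hockey zero    = sym (k>n⇒nCk≡0 {0} {suc k} (s≤s z≤n))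
  hockey (suc n) = trans (cong (n C k +_) (hockey n)) (nCk+nC[k+1]≡[n+1]C[k+1] n k)

-- Coefficients of the polynomials `P a`

∑0 : ∀ is {f : ℕ → ℕ} → (∀ i → f i ≡ 0) → ∑ is f ≡ 0
∑0 []       f≡0 = refl
∑0 (i ∷ is) f≡0 = cong₂ _+_ (f≡0 i) (∑0 is f≡0)

∑-applyUpTo0 : ∀ n (g f : ℕ → ℕ) → (∀ i → f (g i) ≡ 0) → ∑ (applyUpTo g n) f ≡ 0
∑-applyUpTo0 zero    g f f≡0 = refl
∑-applyUpTo0 (suc n) g f f≡0 = cong₂ _+_ (f≡0 0) (∑-applyUpTo0 n (g ∘ suc) f (f≡0 ∘ suc))

1+x⊛-suc : ∀ q u → (1+x ⊛ q) (suc u) ≡ q (suc u) + q u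
1+x⊛-suc q u rewrite ∑-applyUpTo0 u (suc ∘ suc) (λ i → 1+x i * q (suc u ∸ i)) (λ _ → refl)
  | +-identityʳ (q (suc u)) | +-identityʳ (q u) | +-identityʳ (q u) = refl

1+x²⊛-suc² : ∀ q u → (1+x² ⊛ q) (2 + u) ≡ q (2 + u) + q u
1+x²⊛-suc² q u rewrite ∑-applyUpTo0 u (suc ∘ suc ∘ suc) (λ i → 1+x² i * q (2 + u ∸ i)) (λ _ → refl)
  | +-identityʳ (q (2 + u)) | +-identityʳ (q u) | +-identityʳ (q u) = refl

-- Telescoping q^(m+1) − q^m = x q^m (resp. x² q^m) turns coefficients of
-- powers into iterated sums, which grow additively in a loop.
1+x^ᶠ : ∀ {A f} → FP A nat f → ∀ u → FP A nat (λ x → (1+x ^ᵖ f x) u)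
1+x^ᶠ {f = f} F zero    = FP-ext (λ x → go (f x)) (constᶠ 1)
  where
  go : ∀ m → 1 ≡ (1+x ^ᵖ m) 0
  go zero    = refl
  go (suc m) = trans (go m) (sym (trans (+-identityʳ _) (+-identityʳ _)))
1+x^ᶠ {f = f} F (suc u) = FP-ext (λ x → go (f x)) (∑<ᶠ (1+x^ᶠ idᶠ u) F)
  where
  go : ∀ m → ∑ (downFrom m) (λ i → (1+x ^ᵖ i) u) ≡ (1+x ^ᵖ m) (suc u)
  go zero    = refl
  go (suc m) = trans (trans (cong ((1+x ^ᵖ m) u +_) (go m)) (+-comm ((1+x ^ᵖ m) u) _)) (sym (1+x⊛-suc (1+x ^ᵖ m) u))

1+x²^ᶠ : ∀ {A f} → FP A nat f → ∀ u → FP A nat (λ x → (1+x² ^ᵖ f x) u)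
1+x²^ᶠ {f = f} F 0 = FP-ext (λ x → go (f x)) (constᶠ 1)
  where
  go : ∀ m → 1 ≡ (1+x² ^ᵖ m) 0
  go zero    = refl
  go (suc m) = trans (go m) (sym (trans (+-identityʳ _) (+-identityʳ _)))
1+x²^ᶠ {f = f} F 1 = FP-ext (λ x → go (f x)) (constᶠ 0)
  where
  go : ∀ m → 0 ≡ (1+x² ^ᵖ m) 1
  go zero    = refl
  go (suc m) = trans (go m) (sym (trans (+-identityʳ _) (+-identityʳ _)))
1+x²^ᶠ {f = f} F (suc (suc u)) = FP-ext (λ x → go (f x)) (∑<ᶠ (1+x²^ᶠ idᶠ u) F)
  where
  go : ∀ m → ∑ (downFrom m) (λ i → (1+x² ^ᵖ i) u) ≡ (1+x² ^ᵖ m) (2 + u)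
  go zero    = refl
  go (suc m) = trans (trans (cong ((1+x² ^ᵖ m) u +_) (go m)) (+-comm ((1+x² ^ᵖ m) u) _)) (sym (1+x²⊛-suc² (1+x² ^ᵖ m) u))

εᶠ : ∀ {A f} → FP A nat f → FP A nat (λ x → ε (f x))
εᶠ {f = f} F = FP-ext (λ x → go (f x) (2 ∣? f x)) (ifzᶠ (remainderᶠ F (constᶠ 2)) (constᶠ 1) (constᶠ 0))
  where
  go : ∀ a (even? : Dec (2 ∣ a)) → ifz (remainder a 2) 1 0 ≡ (if does even? then 1 else 0)
  go a (yes 2∣a) rewrite ∣⇒remainder≡0 (s≤s z≤n) 2∣a = refl
  go a (no  2∤a) with remainder a 2 in eq
  ... | zero  = contradiction (remainder≡0⇒∣ (s≤s z≤n) eq) 2∤a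
  ... | suc _ = refl

Iᶠ : ∀ {A f} → FP A nat f → ∀ u → FP A nat (λ x → I (f x) u)
Iᶠ {f = f} F u = ∑ᶠ (λ i → FP-ext (λ x → cong (λ m → (1+x² ^ᵖ m) i) (quot≡div (f x ∸ 1) (s≤s z≤n)))
                            (1+x²^ᶠ (quotᶠ (F ∸ᶠ constᶠ 1) (constᶠ 2)) i)
                        *ᶠ 1+x^ᶠ (εᶠ F) (u ∸ i)) (0⋯ u)

-- The enumeration of transitions

words : ℕ → ℕ → List (List ℕ)
words d zero    = [ [] ]
words d (suc n) = concatMap (λ c → map (c ∷_) (words d n)) (0⋯ d)

nth : List ℕ → ℕ → ℕ
nth []       _       = 0
nth (c ∷ cs) zero    = c
nth (c ∷ cs) (suc i) = nth cs i

∈-concatMap-find : ∀ {X Y : Set} (f : X → List Y) xs {y} → y ∈ concatMap f xs → ∃[ x ] x ∈ xs × y ∈ f x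
∈-concatMap-find f xs y∈ = find (∈-concatMap⁻ f {xs} y∈)

-- Isolates the one word that spends no budget; a positive letter in any other word will cost at
-- least one unit.
words-zero∷ : ∀ d n → ∃[ ws ] words d n ≡ replicate n 0 ∷ ws ×
              (∀ {x} → x ∈ ws → ∃[ i ] i < n × 0 < nth x i)
words-zero∷ d zero    = [] , refl , λ ()
words-zero∷ d (suc n) with words-zero∷ d n
... | ws , eq , pos = map (0 ∷_) ws ++ rest , cong (λ w → map (0 ∷_) w ++ rest) eq , pos′
  where
  rest = concatMap (λ c → map (c ∷_) (words d n)) (applyUpTo suc d)
  pos′ : ∀ {x} → x ∈ map (0 ∷_) ws ++ rest → ∃[ i ] i < suc n × 0 < nth x i
  pos′ x∈ with ∈-++⁻ (map (0 ∷_) ws) x∈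
  ... | inj₁ x∈ˡ with ∈-map⁻ (0 ∷_) x∈ˡ
  ...   | y , y∈ , refl with pos y∈
  ...     | i , i<n , p = suc i , s≤s i<n , p
  pos′ x∈ | inj₂ x∈ʳ with ∈-concatMap-find (λ c → map (c ∷_) (words d n)) (applyUpTo suc d) x∈ʳ
  ... | c , c∈ , x∈c with ∈-applyUpTo⁻ suc c∈ | ∈-map⁻ (c ∷_) x∈c
  ...   | i , i<d , refl | y , y∈ , refl = 0 , s≤s z≤n , s≤s z≤n

nth-replicate : ∀ n i → nth (replicate n 0) i ≡ 0
nth-replicate zero    i       = refl
nth-replicate (suc n) zero    = refl
nth-replicate (suc n) (suc i) = nth-replicate n i

∈-1⋯⁺ : ∀ {n i} → i < n → suc i ∈ 1⋯ n
∈-1⋯⁺ i<n = ∈-map⁺ suc (∈-upTo⁺ i<n)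

∑≡0⇒≡0 : ∀ is (f : ℕ → ℕ) → ∑ is f ≡ 0 → ∀ {i} → i ∈ is → f i ≡ 0
∑≡0⇒≡0 (i ∷ is) f e (here refl) = m+n≡0⇒m≡0 (f i) e
∑≡0⇒≡0 (i ∷ is) f e (there i∈)  = ∑≡0⇒≡0 is f (m+n≡0⇒n≡0 (f i) e) i∈

ifz-∈ : ∀ {X : Set} c {x y : X} → y ∈ ifz c [ x ] [] → c ≡ 0 × y ≡ x
ifz-∈ zero (here eq) = refl , eq

-- The factor `W` of a row without division: the multinomial coefficient is a product of binomials
-- of successive remainders, and what is left over for k = 0 contributes the factor 1. The
-- factorials in `W` would be too large as unary numbers.
multi : (ℕ → ℕ) → ℕ → ℕ → List ℕ → ℕ
multi f g h []       = 1
multi f g h (k ∷ ks) = (h C f k) * (g C k) ^ f k * multi f g (h ∸ f k) ks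

multi≡1 : ∀ f g h ks → (∀ {k} → k ∈ ks → f k ≡ 0) → multi f g h ks ≡ 1
multi≡1 f g h []       _ = refl
multi≡1 f g h (k ∷ ks) z rewrite z (here refl) | nC0≡1 h | multi≡1 f g h ks (z ∘ there) = refl

multi-cong : ∀ {f f′} g h ks → (∀ {k} → k ∈ ks → f k ≡ f′ k) → multi f g h ks ≡ multi f′ g h ks
multi-cong g h []       f≡f′ = refl
multi-cong {f} {f′} g h (k ∷ ks) f≡f′ rewrite f≡f′ (here refl) =
  cong ((h C f′ k) * (g C k) ^ f′ k *_) (multi-cong g (h ∸ f′ k) ks (f≡f′ ∘ there))

≤sum : ∀ {X : Set} (f : X → ℕ) xs {x} → x ∈ xs → f x ≤ sum (map f xs)
≤sum f (x ∷ xs) (here refl) = m≤m+n _ _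
≤sum f (x ∷ xs) (there x∈)  = ≤-trans (≤sum f xs x∈) (m≤n+m _ _)

RowTy ItemTy PartialTy : Ty
RowTy     = nat ⊗ nat ⊗ nat
ItemTy    = nat ⊗ nat ⊗ nat ⊗ nat
PartialTy = TransitionTy ⊗ nat

residual : ⟦ PartialTy ⟧ → ℕ
residual ((R , _) , _) = R

-- A row is an entry (b , s , c) of the input state.  A partial transition
-- ((R , ν) , w) has assigned ν on some rows, has weight w so far and leaves R
-- of the total r.  In each row the values of ν at k = 1, …, d range over the
-- finitely many words over {0, …, d}; the value at k = 0 is then forced.
module Enumeration (d : ℕ) where

  dot : (ℕ → ℕ) → ℕ
  dot f = ∑ (1⋯ d) λ k → k * f k

  fill : ℕ → (ℕ → ℕ) → ℕ → ℕ
  fill h f zero    = h ∸ ∑ (1⋯ d) f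
  fill h f (suc k) = f (suc k)

  items : ℕ → ℕ → (ℕ → ℕ) → List ⟦ ItemTy ⟧
  items b s f = concatMap (λ k → ifz (f k) [] [ (b , s , k , f k) ]) (0⋯ d)

  module Row (a r : ℕ) (row : ⟦ RowTy ⟧) where

    private
      b s c : ℕ
      b = proj₁ row
      s = proj₁ (proj₂ row)
      c = proj₂ (proj₂ row)

    height g α′ β′ : ℕ
    -- The sum of truncated differences vanishes exactly on the pivot row.
    height = ifz ((b ∸ a) + (a ∸ b) + ((s ∸ r) + (r ∸ s))) (pred c) c
    g = largestDivisor a b
    -- max 1 (b / g): on malformed rows too, nonzero choices spend budget, so
    -- that the bounds below hold on every input.
    α′ = suc (pred (quot b g))
    β′ = quot a g

    used : (ℕ → ℕ) → ℕ
    used f = α′ * dot f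

    -- Vanishes exactly when f is admissible in this row with budget R.
    excess : (ℕ → ℕ) → ℕ → ℕ
    excess f R = (∑ (1⋯ d) f ∸ height) + (used f ∸ R)
      + ∑ (1⋯ d) (λ k → f k * ((k ∸ g) + (k ∸ quot r α′) + (k ∸ quot s β′)))

    assign : (ℕ → ℕ) → ⟦ PartialTy ⟧ → ⟦ PartialTy ⟧
    assign f ((R , ν) , w) =
      (R ∸ used f , items b s (fill height f) ++ ν) , multi f g height (1⋯ d) * w

    extend : ⟦ PartialTy ⟧ → List ⟦ PartialTy ⟧
    -- The 0 in front shifts the letters of `x` to the indices 1, ..., d; the true value at 0 is
    -- supplied by `fill`.
    extend p = concatMap (λ x → ifz (excess (nth (0 ∷ x)) (residual p)) [ assign (nth (0 ∷ x)) p ] []) (words d d)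

    ∈-extend⁻ : ∀ {p q} → q ∈ extend p →
      ∃[ x ] x ∈ words d d × excess (nth (0 ∷ x)) (residual p) ≡ 0 × q ≡ assign (nth (0 ∷ x)) p
    ∈-extend⁻ {p} q∈ with ∈-concatMap-find _ (words d d) q∈
    ... | x , x∈ , q∈ = x , x∈ , ifz-∈ (excess (nth (0 ∷ x)) (residual p)) q∈

    excess≡0⇒used≤ : ∀ f R → excess f R ≡ 0 → used f ≤ R
    excess≡0⇒used≤ f R e = m∸n≡0⇒m≤n (m+n≡0⇒n≡0 (∑ (1⋯ d) f ∸ height) (m+n≡0⇒m≡0 _ e))

    used≡0⇒≡0 : ∀ f → used f ≡ 0 → ∀ {i} → i < d → f (suc i) ≡ 0
    used≡0⇒≡0 f e {i} i<d = m+n≡0⇒m≡0 (f (suc i))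
      (∑≡0⇒≡0 (1⋯ d) (λ k → k * f k) (m+n≡0⇒m≡0 (dot f) e) (∈-1⋯⁺ i<d))

  -- The budget is min d r.
  start : ℕ → ⟦ PartialTy ⟧
  start r = (d ∸ (d ∸ r) , []) , 1

  enumerate : ℕ → ℕ → List ⟦ RowTy ⟧ → List ⟦ PartialTy ⟧
  enumerate a r = foldr (λ row L → concatMap (Row.extend a r row) L) [ start r ]

  -- The coefficient `I a u` is available as a program only for constant `u`. So every `u` up to `d`
  -- is tried, and the one equal to the residual survives.
  finish : ℕ → ⟦ PartialTy ⟧ → List ⟦ PartialTy ⟧
  finish a ((R , ν) , w) = concatMap (λ u → ifz ((R ∸ u) + (u ∸ R)) [ ((R , ν) , I a u * w) ] []) (0⋯ d)

  generate : ⟦ InputTy ⟧ → ⟦ OutputTy ⟧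
  generate (H , a , r) = concatMap (finish a) (enumerate a r H)

  -- The generating function of the residual budgets, used as a potential: extending all partial
  -- transitions by a row costs no more than replacing `y` by `y + branching`. At y = 1 it counts
  -- the list.
  Φ : ℕ → List ⟦ PartialTy ⟧ → ℕ
  Φ y L = sum (map (λ p → y ^ residual p) L)

  Φ-++ : ∀ y L L′ → Φ y (L ++ L′) ≡ Φ y L + Φ y L′
  Φ-++ y []      L′ = refl
  Φ-++ y (p ∷ L) L′ = trans (cong (y ^ residual p +_) (Φ-++ y L L′)) (sym (+-assoc (y ^ residual p) _ _))

  Φ-concatMap : ∀ {X : Set} y (f : X → List ⟦ PartialTy ⟧) B xs → (∀ {x} → x ∈ xs → Φ y (f x) ≤ B) →
                Φ y (concatMap f xs) ≤ length xs * B
  Φ-concatMap y f B []       h = z≤n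
  Φ-concatMap y f B (x ∷ xs) h = ≤-trans (≤-reflexive (Φ-++ y (f x) (concatMap f xs)))
    (+-mono-≤ (h (here refl)) (Φ-concatMap y f B xs (h ∘ there)))

  branching : ℕ
  branching = length (words d d)

  -- Every choice but the zero word spends some of the budget.
  Φ-extend : ∀ a r row y .{{_ : NonZero y}} p → Φ y (Row.extend a r row p) ≤ (y + branching) ^ residual p
  Φ-extend a r row y p@((R , _) , _) with words d d | words-zero∷ d d
  ... | _ | ws , refl , pos = ≤-trans (≤-reflexive (Φ-++ y (ext _) (concatMap ext ws)))
    (≤-trans (+-mono-≤ first (Φ-concatMap y ext (B R) ws (λ x∈ → others R (pos x∈)))) (total≤ R))
    where
    open Row a r row
    ext : List ℕ → List ⟦ PartialTy ⟧
    ext x = ifz (excess (nth (0 ∷ x)) R) [ assign (nth (0 ∷ x)) p ] []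

    first : Φ y (ext (replicate d 0)) ≤ y ^ R
    first with excess (nth (0 ∷ replicate d 0)) R
    ... | suc _ = z≤n
    ... | zero  = ≤-trans (≤-reflexive (+-identityʳ _)) (^-monoʳ-≤ y (m∸n≤m R (used (nth (0 ∷ replicate d 0)))))

    -- A nonzero word leaves a residual of at most R ∸ 1, and with R = 0 none is affordable.
    B : ℕ → ℕ
    B zero    = 0
    B (suc R) = y ^ R

    others : ∀ R {x} → (∃[ i ] i < d × 0 < nth x i) →
             Φ y (ifz (excess (nth (0 ∷ x)) R) [ assign (nth (0 ∷ x)) ((R , proj₂ (proj₁ p)) , proj₂ p) ] []) ≤ B R
    others R {x} (i , i<d , pos) with excess (nth (0 ∷ x)) R in eq
    ... | suc _ = z≤n
    ... | zero with used (nth (0 ∷ x)) in u | excess≡0⇒used≤ (nth (0 ∷ x)) R eq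
    ...   | zero  | _ = contradiction (used≡0⇒≡0 (nth (0 ∷ x)) u i<d) (m<n⇒n≢0 pos)
    others (suc R) _ | zero | suc v | s≤s _ =
      ≤-trans (≤-reflexive (+-identityʳ _)) (^-monoʳ-≤ y (m∸n≤m R v))

    total≤ : ∀ R → y ^ R + length ws * B R ≤ (y + suc (length ws)) ^ R
    total≤ zero    = ≤-reflexive (cong suc (*-zeroʳ (length ws)))
    total≤ (suc R) = ≤-trans (≤-reflexive (sym (*-distribʳ-+ (y ^ R) y (length ws))))
      (*-mono-≤ (+-monoʳ-≤ y (n≤1+n _)) (^-monoˡ-≤ R (m≤m+n y _)))

  residual-start≤d : ∀ r → residual (start r) ≤ d
  residual-start≤d r = m∸n≤m d (d ∸ r)

  -- Every row shifts `y`, so the induction hypothesis is applied at `y + branching` and `y` has to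
  -- be general.
  Φ-enumerate : ∀ a r rows y .{{_ : NonZero y}} → Φ y (enumerate a r rows) ≤ (y + length rows * branching) ^ d
  Φ-enumerate a r []           y = ≤-trans (≤-reflexive (+-identityʳ _))
    (≤-trans (^-monoʳ-≤ y (residual-start≤d r)) (≤-reflexive (cong (_^ d) (sym (+-identityʳ y)))))
  Φ-enumerate a r (row ∷ rows) y = ≤-trans (step (enumerate a r rows))
    (≤-trans (Φ-enumerate a r rows (y + branching) {{>-nonZero (≤-trans (>-nonZero⁻¹ y) (m≤m+n y _))}})
      (≤-reflexive (cong (_^ d) (+-assoc y branching _))))
    where
    step : ∀ L → Φ y (concatMap (Row.extend a r row) L) ≤ Φ (y + branching) L
    step []      = z≤n
    step (p ∷ L) = ≤-trans (≤-reflexive (Φ-++ y (Row.extend a r row p) _))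
      (+-mono-≤ (Φ-extend a r row y p) (step L))

  length-enumerate : ∀ a r rows → length (enumerate a r rows) ≤ (1 + length rows * branching) ^ d
  length-enumerate a r rows = ≤-trans (≤-reflexive (length≡Φ (enumerate a r rows))) (Φ-enumerate a r rows 1)
    where
    length≡Φ : ∀ L → length L ≡ Φ 1 L
    length≡Φ []      = refl
    length≡Φ (p ∷ L) = cong₂ _+_ (sym (^-zeroˡ (residual p))) (length≡Φ L)

  -- Sums over all words in place of maxima: each bounds the contribution of any single word, and
  -- `≼` is closed under finite sums.
  items≤ multi≤ : ⟦ RowTy ⊗ InputTy ⟧ → ℕ
  items≤ ((b , s , c) , _ , a , r) =
    sum (map (λ x → size (list ItemTy) (items b s (fill (Row.height a r (b , s , c)) (nth (0 ∷ x))))) (words d d))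
  multi≤ (row , _ , a , r) =
    sum (map (λ x → multi (nth (0 ∷ x)) (Row.g a r row) (Row.height a r row) (1⋯ d)) (words d d))

  record Bounded (G F len : ℕ) (p : ⟦ PartialTy ⟧) : Set where
    field
      R≤d : residual p ≤ d
      ν≤  : size (list ItemTy) (proj₂ (proj₁ p)) ≤ len * G
      -- Each unit of the budget pays for one factor F.
      w≤  : proj₂ p * F ^ residual p ≤ F ^ d

  enumerate-bounded : ∀ (e : ⟦ InputTy ⟧) G F .{{_ : NonZero F}} rows →
    (∀ {row} → row ∈ rows → items≤ (row , e) ≤ G × multi≤ (row , e) ≤ F) →
    ∀ {p} → p ∈ enumerate (proj₁ (proj₂ e)) (proj₂ (proj₂ e)) rows → Bounded G F (length rows) p
  enumerate-bounded (_ , a , r) G F [] h (here refl) = record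
    { R≤d = residual-start≤d r
    ; ν≤  = z≤n
    ; w≤  = ≤-trans (≤-reflexive (+-identityʳ _)) (^-monoʳ-≤ F (residual-start≤d r)) }
  enumerate-bounded e@(_ , a , r) G F (row@(b , s , c) ∷ rows) h p∈
    with ∈-concatMap-find (Row.extend a r row) (enumerate a r rows) p∈
  ... | q , q∈ , p∈ with Row.∈-extend⁻ a r row p∈
  ...   | x , x∈ , ex , refl = record
    { R≤d = ≤-trans (m∸n≤m (residual q) (used f)) R≤d
    ; ν≤  = ≤-trans (≤-reflexive (size-++ ItemTy (items b s (fill height f)) _))
              (+-mono-≤ (≤-trans (≤sum _ (words d d) x∈) (proj₁ (h (here refl)))) ν≤)
    ; w≤  = w≤′ (used f) refl (excess≡0⇒used≤ f (residual q) ex) }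
    where
    open Row a r row
    open Bounded (enumerate-bounded e G F rows (h ∘ there) q∈)
    f = nth (0 ∷ x)
    w = proj₂ q
    M = multi f g height (1⋯ d)

    w≤′ : ∀ u → used f ≡ u → u ≤ residual q → M * w * F ^ (residual q ∸ u) ≤ F ^ d
    w≤′ zero u≡ _ = ≤-trans (≤-reflexive (cong (_* F ^ residual q)
      (trans (cong (_* w) (multi≡1 f g height (1⋯ d) zeros)) (+-identityʳ w)))) w≤
      where
      zeros : ∀ {k} → k ∈ 1⋯ d → f k ≡ 0
      zeros k∈ with ∈-map⁻ suc k∈
      ... | i , i∈ , refl with ∈-applyUpTo⁻ id i∈
      ...   | j , j<d , refl = used≡0⇒≡0 f u≡ j<d
    w≤′ (suc u) _ u<R = ≤-trans (begin
      M * w * F ^ (residual q ∸ suc u)         ≤⟨ *-mono-≤ (*-monoˡ-≤ w (≤-trans (≤sum _ (words d d) x∈) (proj₂ (h (here refl)))))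
                                                    (^-monoʳ-≤ F (∸-monoʳ-≤ (residual q) (s≤s (z≤n {u})))) ⟩
      F * w * F ^ (residual q ∸ 1)             ≡⟨ cong (_* F ^ (residual q ∸ 1)) (*-comm F w) ⟩
      w * F * F ^ (residual q ∸ 1)             ≡⟨ *-assoc w F _ ⟩
      w * F ^ suc (residual q ∸ 1)             ≡⟨ cong (λ R → w * F ^ R) (m+[n∸m]≡n {1} (≤-trans (s≤s z≤n) u<R)) ⟩
      w * F ^ residual q                       ∎) w≤
      where open ≤-Reasoning

-- The enumeration as a polynomial-time program

module _ (d : ℕ) where
  open Enumeration d
  private
    E = RowTy ⊗ InputTy

    bᶠ : FP E nat (λ ((b , s , c) , H , a , r) → b)
    bᶠ = fstᶠ (fstᶠ idᶠ)
    sᶠ : FP E nat (λ ((b , s , c) , H , a , r) → s)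
    sᶠ = fstᶠ (sndᶠ (fstᶠ idᶠ))
    cᶠ : FP E nat (λ ((b , s , c) , H , a , r) → c)
    cᶠ = sndᶠ (sndᶠ (fstᶠ idᶠ))
    aᶠ : FP E nat (λ ((b , s , c) , H , a , r) → a)
    aᶠ = fstᶠ (sndᶠ (sndᶠ idᶠ))
    rᶠ : FP E nat (λ ((b , s , c) , H , a , r) → r)
    rᶠ = sndᶠ (sndᶠ (sndᶠ idᶠ))

    heightᶠ : FP E nat (λ (row , H , a , r) → Row.height a r row)
    heightᶠ = ifzᶠ ((bᶠ ∸ᶠ aᶠ) +ᶠ (aᶠ ∸ᶠ bᶠ) +ᶠ ((sᶠ ∸ᶠ rᶠ) +ᶠ (rᶠ ∸ᶠ sᶠ))) (predᶠ cᶠ) cᶠ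

    gᶠ : FP E nat (λ (row , H , a , r) → Row.g a r row)
    gᶠ = largestDivisorᶠ aᶠ bᶠ

    αᶠ : FP E nat (λ (row , H , a , r) → Row.α′ a r row)
    αᶠ = sucᶠ (predᶠ (quotᶠ bᶠ gᶠ))

    βᶠ : FP E nat (λ (row , H , a , r) → Row.β′ a r row)
    βᶠ = quotᶠ aᶠ gᶠ

    usedᶠ : ∀ f → FP E nat (λ (row , H , a , r) → Row.used a r row f)
    usedᶠ f = αᶠ *ᶠ constᶠ (dot f)

    T = PartialTy ⊗ E

    excessᶠ : ∀ f → FP T nat (λ (p , row , H , a , r) → Row.excess a r row f (residual p))
    excessᶠ f = (constᶠ (∑ (1⋯ d) f) ∸ᶠ heightᶠ ∘ᶠ π) +ᶠ (usedᶠ f ∘ᶠ π ∸ᶠ fstᶠ (fstᶠ (fstᶠ idᶠ)))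
      +ᶠ ∑ᶠ (λ k → constᶠ (f k) *ᶠ ((constᶠ k ∸ᶠ gᶠ) +ᶠ (constᶠ k ∸ᶠ quotᶠ rᶠ αᶠ) +ᶠ (constᶠ k ∸ᶠ quotᶠ sᶠ βᶠ))) (1⋯ d) ∘ᶠ π
      where
      π : FP T E proj₂
      π = sndᶠ idᶠ

    itemsᶠ : ∀ f → FP E (list ItemTy) (λ (row , H , a , r) →
             items (proj₁ row) (proj₁ (proj₂ row)) (fill (Row.height a r row) f))
    itemsᶠ f = ⋃ᶠ (λ k → ifzᶠ (fillᶠ k) []ᶠ (⟨ bᶠ , ⟨ sᶠ , ⟨ constᶠ k , fillᶠ k ⟩ᶠ ⟩ᶠ ⟩ᶠ ∷ᶠ []ᶠ)) (0⋯ d)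
      where
      fillᶠ : ∀ k → FP E nat (λ (row , H , a , r) → fill (Row.height a r row) f k)
      fillᶠ zero    = heightᶠ ∸ᶠ constᶠ (∑ (1⋯ d) f)
      fillᶠ (suc k) = constᶠ (f (suc k))

    multiᶠ : ∀ f ks {h} → FP E nat h → FP E nat (λ e → multi f (Row.g (proj₁ (proj₂ (proj₂ e))) (proj₂ (proj₂ (proj₂ e))) (proj₁ e)) (h e) ks)
    multiᶠ f []       hᶠ = constᶠ 1
    multiᶠ f (k ∷ ks) hᶠ = Cᶠ hᶠ (f k) *ᶠ (Cᶠ gᶠ k ^ᶠ f k) *ᶠ multiᶠ f ks (hᶠ ∸ᶠ constᶠ (f k))

    assignᶠ : ∀ f → FP T PartialTy (λ (p , row , H , a , r) → Row.assign a r row f p)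
    assignᶠ f = ⟨ ⟨ fstᶠ (fstᶠ (fstᶠ idᶠ)) ∸ᶠ usedᶠ f ∘ᶠ π , itemsᶠ f ∘ᶠ π ++ᶠ sndᶠ (fstᶠ (fstᶠ idᶠ)) ⟩ᶠ
                , multiᶠ f (1⋯ d) heightᶠ ∘ᶠ π *ᶠ sndᶠ (fstᶠ idᶠ) ⟩ᶠ
      where
      π : FP T E proj₂
      π = sndᶠ idᶠ

    extendᶠ : FP T (list PartialTy) (λ (p , row , H , a , r) → Row.extend a r row p)
    extendᶠ = ⋃ᶠ (λ x → ifzᶠ (excessᶠ (nth (0 ∷ x))) (assignᶠ (nth (0 ∷ x)) ∷ᶠ []ᶠ) []ᶠ) (words d d)

    stepᶠ : FP (list PartialTy ⊗ E) (list PartialTy) (λ (L , row , H , a , r) → concatMap (Row.extend a r row) L)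
    stepᶠ = concatMapᶠ (fstᶠ idᶠ) (extendᶠ ∘ᶠ ⟨ fstᶠ idᶠ , sndᶠ (sndᶠ idᶠ) ⟩ᶠ)

    startᶠ : FP InputTy (list PartialTy) (λ (H , a , r) → [ start r ])
    startᶠ = ⟨ ⟨ constᶠ d ∸ᶠ (constᶠ d ∸ᶠ sndᶠ (sndᶠ idᶠ)) , []ᶠ ⟩ᶠ , constᶠ 1 ⟩ᶠ ∷ᶠ []ᶠ

    items≼ : items≤ ≼ size E
    items≼ = ≼-∑ (λ x → size≼ (itemsᶠ (nth (0 ∷ x)))) (words d d)

    multi≼ : multi≤ ≼ size E
    multi≼ = size≼ (∑ᶠ (λ x → multiᶠ (nth (0 ∷ x)) (1⋯ d) heightᶠ) (words d d))

    -- G and F bound the items and the weight that a single row can contribute.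
    S G F size≤ : ⟦ InputTy ⟧ → ℕ
    S (H , a , r) = size StateTy H
    G e = (2 + (S e + size InputTy e)) ^ proj₁ items≼
    F e = suc ((2 + (S e + size InputTy e)) ^ proj₁ multi≼)
    size≤ e = (1 + S e * branching) ^ d * suc (d + S e * G e + F e ^ d)

    size≤≼ : size≤ ≼ size InputTy
    size≤≼ = ≼-* (≼-^ (≼-suc (≼-* S≼ (≼-const branching))) d)
                 (≼-suc (≼-+ (≼-+ (≼-const d) (≼-* S≼ (≼-^ S+≼ (proj₁ items≼)))) (≼-^ (≼-suc (≼-^ S+≼ (proj₁ multi≼))) d)))
      where
      S≼ : S ≼ size InputTy
      S≼ = size≼ {InputTy} {StateTy} (fstᶠ idᶠ)
      S+≼ : (λ e → 2 + (S e + size InputTy e)) ≼ size InputTy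
      S+≼ = ≼-+ (≼-const 2) (≼-+ S≼ ≼-refl)

    -- The number of partial transitions times a bound for the size of one. All bounds refer to the
    -- whole input, although only the suffix `ys` has been processed, because the bound of a fold
    -- depends on the environment alone.
    enumerate-size : ∀ e ys zs → proj₁ e ≡ zs ++ ys →
      size (list PartialTy) (enumerate (proj₁ (proj₂ e)) (proj₂ (proj₂ e)) ys) ≤ size≤ e
    enumerate-size e@(H , a , r) ys zs eq = begin
      size (list PartialTy) L              ≤⟨ size-list≤ PartialTy L (d + S e * G e + F e ^ d) partial≤ ⟩
      length L * suc (d + S e * G e + F e ^ d)
        ≤⟨ *-monoˡ-≤ _ (≤-trans (length-enumerate a r ys) (^-monoˡ-≤ d (s≤s (*-monoˡ-≤ branching length≤)))) ⟩
      size≤ e                              ∎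
      where
      open ≤-Reasoning
      L = enumerate a r ys

      length≤ : length ys ≤ S e
      length≤ = ≤-trans (≤-trans (m≤n+m (length ys) (length zs)) (≤-reflexive (sym (trans (cong length eq) (length-++ zs)))))
                        (length≤size RowTy H)

      row≤ : ∀ {row} → row ∈ ys → size RowTy row ≤ S e
      row≤ row∈ = ∈⇒size≤ RowTy (subst (_ ∈_) (sym eq) (∈-++⁺ʳ zs row∈))

      env≤ : ∀ {row} k → row ∈ ys → (2 + (size RowTy row + size InputTy e)) ^ k ≤ (2 + (S e + size InputTy e)) ^ k
      env≤ k row∈ = ^-monoˡ-≤ k (s≤s (s≤s (+-monoˡ-≤ (size InputTy e) (row≤ row∈))))

      partial≤ : ∀ {p} → p ∈ L → size PartialTy p ≤ d + S e * G e + F e ^ d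
      partial≤ {p} p∈ = +-mono-≤ (+-mono-≤ R≤d (≤-trans ν≤ (*-monoˡ-≤ (G e) length≤)))
        (≤-trans (m≤m*n (proj₂ p) (F e ^ residual p) ⦃ m^n≢0 (F e) (residual p) ⦄) w≤)
        where
        row-bounded : ∀ {row} → row ∈ ys → items≤ (row , e) ≤ G e × multi≤ (row , e) ≤ F e
        row-bounded {row} row∈ = ≤-trans (proj₂ items≼ (row , e)) (env≤ (proj₁ items≼) row∈)
          , ≤-trans (proj₂ multi≼ (row , e)) (≤-trans (env≤ (proj₁ multi≼) row∈) (n≤1+n _))
        open Bounded (enumerate-bounded e (G e) (F e) ys row-bounded p∈)

    enumerateᶠ : FP InputTy (list PartialTy) (λ (H , a , r) → enumerate a r H)
    enumerateᶠ = foldᶠ (fstᶠ idᶠ) startᶠ stepᶠ size≤≼ enumerate-size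

    finishᶠ : FP (PartialTy ⊗ InputTy) OutputTy (λ (p , H , a , r) → finish a p)
    finishᶠ = ⋃ᶠ (λ u → ifzᶠ ((Rᶠ ∸ᶠ constᶠ u) +ᶠ (constᶠ u ∸ᶠ Rᶠ))
                    (⟨ fstᶠ (fstᶠ idᶠ) , Iᶠ (fstᶠ (sndᶠ (sndᶠ idᶠ))) u *ᶠ sndᶠ (fstᶠ idᶠ) ⟩ᶠ ∷ᶠ []ᶠ) []ᶠ) (0⋯ d)
      where
      Rᶠ : FP (PartialTy ⊗ InputTy) nat (λ (p , _) → residual p)
      Rᶠ = fstᶠ (fstᶠ (fstᶠ idᶠ))

  generateᶠ : FP InputTy OutputTy generate
  generateᶠ = concatMapᶠ enumerateᶠ finishᶠ

-- Correctness of the enumeration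

∑-cong : ∀ is {f g : ℕ → ℕ} → (∀ {i} → i ∈ is → f i ≡ g i) → ∑ is f ≡ ∑ is g
∑-cong []       f≡g = refl
∑-cong (i ∷ is) f≡g = cong₂ _+_ (f≡g (here refl)) (∑-cong is (f≡g ∘ there))

concatMap-cong-∈ : ∀ {X Y : Set} xs {f g : X → List Y} → (∀ {x} → x ∈ xs → f x ≡ g x) → concatMap f xs ≡ concatMap g xs
concatMap-cong-∈ []       f≡g = refl
concatMap-cong-∈ (x ∷ xs) f≡g = cong₂ _++_ (f≡g (here refl)) (concatMap-cong-∈ xs (f≡g ∘ there))

concatMap-[] : ∀ {X Y : Set} xs {f : X → List Y} → (∀ {x} → x ∈ xs → f x ≡ []) → concatMap f xs ≡ []
concatMap-[] []       f≡[] = refl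
concatMap-[] (x ∷ xs) f≡[] = cong₂ _++_ (f≡[] (here refl)) (concatMap-[] xs (f≡[] ∘ there))

concatMap-[-] : ∀ {X Y : Set} xs {f : X → List Y} {g : X → Y} → (∀ {x} → x ∈ xs → f x ≡ [ g x ]) → concatMap f xs ≡ map g xs
concatMap-[-] []       h = refl
concatMap-[-] (x ∷ xs) h = cong₂ _++_ (h (here refl)) (concatMap-[-] xs (h ∘ there))

∈-concatMap⁺′ : ∀ {X Y : Set} (f : X → List Y) xs {x y} → x ∈ xs → y ∈ f x → y ∈ concatMap f xs
∈-concatMap⁺′ f xs x∈ y∈ = ∈-concat⁺′ y∈ (∈-map⁺ f x∈)

concatMap-unique : ∀ {X Y : Set} (f : X → List Y) xs → Unique xs → (∀ {x} → x ∈ xs → Unique (f x)) →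
  (∀ {x x′ y} → x ∈ xs → x′ ∈ xs → y ∈ f x → y ∈ f x′ → x ≡ x′) → Unique (concatMap f xs)
concatMap-unique f []       _            _ _   = []
concatMap-unique f (x ∷ xs) (x∉ ∷ uniq) u inj = Unique.++⁺ (u (here refl))
  (concatMap-unique f xs uniq (u ∘ there) λ x∈ x′∈ → inj (there x∈) (there x′∈))
  λ (y∈ , y∈′) → let x′ , x′∈ , y∈fx′ = ∈-concatMap-find f xs y∈′ in
    All.lookup x∉ x′∈ (inj (here refl) (there x′∈) y∈ y∈fx′)

map-unique : ∀ {X Y : Set} (f : X → Y) xs → Unique xs →
  (∀ {x x′} → x ∈ xs → x′ ∈ xs → f x ≡ f x′ → x ≡ x′) → Unique (map f xs)
map-unique f []       _           _   = []
map-unique f (x ∷ xs) (x∉ ∷ uniq) inj = All.map⁺ (All.tabulate λ x′∈ eq → All.lookup x∉ x′∈ (inj (here refl) (there x′∈) eq))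
  ∷ map-unique f xs uniq λ x∈ x′∈ → inj (there x∈) (there x′∈)

∈-1⋯⁻ : ∀ {n k} → k ∈ 1⋯ n → 1 ≤ k × k ≤ n
∈-1⋯⁻ k∈ with ∈-map⁻ suc k∈
... | i , i∈ , refl = s≤s z≤n , ∈-upTo⁻ i∈

1⋯-unique : ∀ n → Unique (1⋯ n)
1⋯-unique n = Unique.map⁺ suc-injective (Unique.upTo⁺ n)

∈-0⋯⁻ : ∀ {n k} → k ∈ 0⋯ n → k ≤ n
∈-0⋯⁻ k∈ = s≤s⁻¹ (∈-upTo⁻ k∈)

0⋯≡0∷1⋯ : ∀ n → 0⋯ n ≡ 0 ∷ 1⋯ n
0⋯≡0∷1⋯ n = cong (0 ∷_) (sym (map-upTo suc n))

∈-words⁺ : ∀ d n (g : ℕ → ℕ) → (∀ i → i < n → g i ≤ d) → applyUpTo g n ∈ words d n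
∈-words⁺ d zero    g g≤d = here refl
∈-words⁺ d (suc n) g g≤d = ∈-concatMap⁺′ (λ c → map (c ∷_) (words d n)) (0⋯ d)
  (∈-upTo⁺ (s≤s (g≤d 0 (s≤s z≤n))))
  (∈-map⁺ (g 0 ∷_) (∈-words⁺ d n (g ∘ suc) λ i i<n → g≤d (suc i) (s≤s i<n)))

length-word : ∀ d n {x} → x ∈ words d n → length x ≡ n
length-word d zero    (here refl) = refl
length-word d (suc n) x∈ with ∈-concatMap-find (λ c → map (c ∷_) (words d n)) (0⋯ d) x∈
... | c , _ , x∈c with ∈-map⁻ (c ∷_) x∈c
...   | y , y∈ , refl = cong suc (length-word d n y∈)

words-unique : ∀ d n → Unique (words d n)
words-unique d zero    = [] ∷ []
words-unique d (suc n) = concatMap-unique (λ c → map (c ∷_) (words d n)) (0⋯ d) (Unique.upTo⁺ (suc d))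
  (λ _ → Unique.map⁺ (λ { refl → refl }) (words-unique d n))
  λ {c} {c′} _ _ x∈ x∈′ → heads c c′ (∈-map⁻ (c ∷_) x∈) (∈-map⁻ (c′ ∷_) x∈′)
  where
  heads : ∀ c c′ {x} → (∃[ y ] y ∈ words d n × x ≡ c ∷ y) → (∃[ y ] y ∈ words d n × x ≡ c′ ∷ y) → c ≡ c′
  heads c c′ (_ , _ , refl) (_ , _ , refl) = refl

nth-applyUpTo : ∀ (g : ℕ → ℕ) n {i} → i < n → nth (applyUpTo g n) i ≡ g i
nth-applyUpTo g (suc n) {zero}  _         = refl
nth-applyUpTo g (suc n) {suc i} (s≤s i<n) = nth-applyUpTo (g ∘ suc) n i<n

nth-beyond : ∀ x {i} → length x ≤ i → nth x i ≡ 0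
nth-beyond []      _                = refl
nth-beyond (_ ∷ x) {suc i} (s≤s ≤i) = nth-beyond x ≤i

nth-injective : ∀ x y → length x ≡ length y → (∀ {i} → i < length x → nth x i ≡ nth y i) → x ≡ y
nth-injective []      []      _ _ = refl
nth-injective (_ ∷ x) (_ ∷ y) l h = cong₂ _∷_ (h (s≤s z≤n)) (nth-injective x y (suc-injective l) (h ∘ s≤s))

div≤ : ∀ m n → m div n ≤ m
div≤ m zero    = z≤n
div≤ m (suc n) = m/n≤m m (suc n)

div≥1 : ∀ {m n} → 1 ≤ n → n ≤ m → 1 ≤ m div n
div≥1 {m} {suc n} _ n≤m = m≥n⇒m/n>0 n≤m

pick : {A X : Set} → Dec A → X → X → X
pick (yes _) x y = x
pick (no  _) x y = y

pick-yes : ∀ {A X : Set} (a? : Dec A) {x y : X} → A → pick a? x y ≡ x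
pick-yes (yes _) _ = refl
pick-yes (no ¬a) a = contradiction a ¬a

pick-no : ∀ {A X : Set} (a? : Dec A) {x y : X} → ¬ A → pick a? x y ≡ y
pick-no (yes a) ¬a = contradiction a ¬a
pick-no (no _)  _  = refl

module Correctness {d : ℕ} (H : State d) (a r : ℕ) (pivot : 0 < entry H a r) where
  open Enumeration d

  range : 1 ≤ a × a ≤ bound H × 1 ≤ r × r ≤ d
  range with (1 ≤? a) ×-dec (a ≤? bound H) ×-dec (1 ≤? r) ×-dec (r ≤? d)
  ... | yes p = p
  ... | no ¬p = contradiction (support H a r ¬p) (m<n⇒n≢0 pivot)

  a≥1 = proj₁ range
  r≤d = proj₂ (proj₂ (proj₂ range))

  module _ {b : ℕ} (s : ℕ) (b≥1 : 1 ≤ b) where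
    private
      row : ⟦ RowTy ⟧
      row = b , s , entry H b s

    open Row a r row

    gcd≥1 : 1 ≤ gcd a b
    gcd≥1 = n≢0⇒n>0 (gcd[m,n]≢0 a b (inj₁ (m<n⇒n≢0 a≥1)))

    α≥1 : 1 ≤ α a b
    α≥1 = div≥1 gcd≥1 (gcd[m,n]≤n a b ⦃ >-nonZero b≥1 ⦄)

    β≥1 : 1 ≤ β a b
    β≥1 = div≥1 gcd≥1 (∣⇒≤ ⦃ >-nonZero a≥1 ⦄ (gcd[m,n]∣m a b))

    g≡ : g ≡ gcd a b
    g≡ = largestDivisor≡gcd b a≥1

    α≡ : α′ ≡ α a b
    α≡ rewrite g≡ | quot≡div b gcd≥1 = m+[n∸m]≡n α≥1

    β≡ : β′ ≡ β a b
    β≡ rewrite g≡ = quot≡div a gcd≥1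

    height≡ : height ≡ h H a r b s
    height≡ = go ((b ≟ a) ×-dec (s ≟ r))
      where
      c = entry H b s
      go : (eq? : Dec (b ≡ a × s ≡ r)) → height ≡ (if does eq? then c ∸ 1 else c)
      go (yes (refl , refl)) rewrite n∸n≡0 b | n∸n≡0 s = refl
      go (no ne) with (b ∸ a) + (a ∸ b) + ((s ∸ r) + (r ∸ s)) in eq
      ... | suc _ = refl
      ... | zero  = contradiction
        ( ≤-antisym (m∸n≡0⇒m≤n (m+n≡0⇒m≡0 (b ∸ a) e₁)) (m∸n≡0⇒m≤n (m+n≡0⇒n≡0 (b ∸ a) e₁))
        , ≤-antisym (m∸n≡0⇒m≤n (m+n≡0⇒m≡0 (s ∸ r) e₂)) (m∸n≡0⇒m≤n (m+n≡0⇒n≡0 (s ∸ r) e₂)) ) ne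
        where
        e₁ = m+n≡0⇒m≡0 ((b ∸ a) + (a ∸ b)) eq
        e₂ = m+n≡0⇒n≡0 ((b ∸ a) + (a ∸ b)) eq

    K≡ : K a r b s ≡ g ⊓ quot r α′ ⊓ quot s β′
    K≡ rewrite α≡ | β≡ | g≡ | quot≡div r α≥1 | quot≡div s β≥1 = refl

    -- The reason why words of length `d` suffice: `K` is at most the quotient of `r` by `α`, hence
    -- at most `r`.
    K≤d : K a r b s ≤ d
    K≤d = ≤-trans (≤-trans (m⊓n≤m _ _) (m⊓n≤n (gcd a b) _)) (≤-trans (div≤ r (α a b)) r≤d)

    excess≡0⁺ : ∀ {f R} → ∑ (1⋯ d) f ≤ height → used f ≤ R → (∀ {k} → K a r b s < k → f k ≡ 0) → excess f R ≡ 0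
    excess≡0⁺ {f} {R} ≤h ≤R beyond = cong₂ _+_ (cong₂ _+_ (m≤n⇒m∸n≡0 ≤h) (m≤n⇒m∸n≡0 ≤R))
      (trans (∑-cong (1⋯ d) {g = λ _ → 0} (λ {k} _ → vanish k)) (∑0 (1⋯ d) λ _ → refl))
      where
      vanish : ∀ k → f k * ((k ∸ g) + (k ∸ quot r α′) + (k ∸ quot s β′)) ≡ 0
      vanish k with k ≤? K a r b s
      ... | no  k≰K rewrite beyond (≰⇒> k≰K) = refl
      ... | yes k≤K rewrite K≡
        | m≤n⇒m∸n≡0 (≤-trans k≤K (≤-trans (m⊓n≤m _ _) (m⊓n≤m g (quot r α′))))
        | m≤n⇒m∸n≡0 (≤-trans k≤K (≤-trans (m⊓n≤m _ _) (m⊓n≤n g (quot r α′))))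
        | m≤n⇒m∸n≡0 (≤-trans k≤K (m⊓n≤n (g ⊓ quot r α′) (quot s β′))) = *-zeroʳ (f k)

    excess≡0⇒≤height : ∀ f R → excess f R ≡ 0 → ∑ (1⋯ d) f ≤ height
    excess≡0⇒≤height f R e = m∸n≡0⇒m≤n (m+n≡0⇒m≡0 (∑ (1⋯ d) f ∸ height) (m+n≡0⇒m≡0 _ e))

    excess≡0⇒beyond : ∀ f R → excess f R ≡ 0 → ∀ {i} → i < d → K a r b s < suc i → f (suc i) ≡ 0
    excess≡0⇒beyond f R e {i} i<d K<k
      with m*n≡0⇒m≡0∨n≡0 (f (suc i)) (∑≡0⇒≡0 (1⋯ d) _ (m+n≡0⇒n≡0 ((∑ (1⋯ d) f ∸ height) + (used f ∸ R)) e) (∈-1⋯⁺ i<d))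
    ... | inj₁ z = z
    ... | inj₂ z = contradiction (⊓-glb (⊓-glb (m∸n≡0⇒m≤n (m+n≡0⇒m≡0 (suc i ∸ g) z₁)) (m∸n≡0⇒m≤n (m+n≡0⇒n≡0 (suc i ∸ g) z₁))) (m∸n≡0⇒m≤n z₂))
                                 (<⇒≱ (subst (_< suc i) K≡ K<k))
      where
      z₁ = m+n≡0⇒m≡0 ((suc i ∸ g) + (suc i ∸ quot r α′)) z
      z₂ = m+n≡0⇒n≡0 ((suc i ∸ g) + (suc i ∸ quot r α′)) z

  Label : Set
  Label = ℕ × ℕ

  Family : Set
  Family = ℕ → ℕ → ℕ → ℕ

  rowOf : Label → ⟦ RowTy ⟧
  rowOf (b , s) = b , s , entry H b s

  -- The conditions of `𝒜` on a single row, with the range of `k` enlarged from `K` to `d` so that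
  -- it is the same for all rows.
  record Fits (b s : ℕ) (f : ℕ → ℕ) : Set where
    field
      rowsum : ∑ (0⋯ d) f ≡ h H a r b s
      beyond : ∀ {k} → K a r b s < k → f k ≡ 0

  open Fits

  -- The partial transition reached by following the choices of `ν`; whether the enumeration admits
  -- this path is the matter of `Good`.
  res : List Label → Family → ⟦ PartialTy ⟧
  res []       ν = start r
  res (l ∷ ls) ν = Row.assign a r (rowOf l) (ν (proj₁ l) (proj₂ l)) (res ls ν)

  Good : List Label → Family → Set
  Good []             ν = ⊤
  Good ((b , s) ∷ ls) ν = Fits b s (ν b s) × Row.used a r (rowOf (b , s)) (ν b s) ≤ residual (res ls ν) × Good ls ν

  residual-res≤d : ∀ ls ν → residual (res ls ν) ≤ d
  residual-res≤d []       ν = residual-start≤d r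
  residual-res≤d (l ∷ ls) ν = ≤-trans (m∸n≤m (residual (res ls ν)) (Row.used a r (rowOf l) (ν (proj₁ l) (proj₂ l))))
                                       (residual-res≤d ls ν)

  on1⋯ : ∀ {f f′ : ℕ → ℕ} → (∀ {i} → i < d → f (suc i) ≡ f′ (suc i)) → ∀ {k} → k ∈ 1⋯ d → f k ≡ f′ k
  on1⋯ f≡f′ {zero}  k∈ = contradiction (proj₁ (∈-1⋯⁻ k∈)) λ ()
  on1⋯ f≡f′ {suc i} k∈ = f≡f′ (proj₂ (∈-1⋯⁻ k∈))

  used-cong : ∀ row {f f′} → (∀ {i} → i < d → f (suc i) ≡ f′ (suc i)) → Row.used a r row f ≡ Row.used a r row f′
  used-cong row {f} {f′} f≡f′ = cong (Row.α′ a r row *_)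
    (∑-cong (1⋯ d) λ {k} k∈ → cong (k *_) (on1⋯ {f} {f′} f≡f′ k∈))

  items-cong : ∀ b s {f f′} → (∀ {k} → k ≤ d → f k ≡ f′ k) → items b s f ≡ items b s f′
  items-cong b s f≡f′ = concatMap-cong-∈ (0⋯ d) λ {k} k∈ → cong (λ c → ifz c [] [ (b , s , k , c) ]) (f≡f′ (∈-0⋯⁻ k∈))

  fill-cong : ∀ h {f f′} → (∀ {i} → i < d → f (suc i) ≡ f′ (suc i)) → ∀ {k} → k ≤ d → fill h f k ≡ fill h f′ k
  fill-cong h {f} {f′} f≡f′ {zero}  _   = cong (h ∸_) (∑-cong (1⋯ d) (on1⋯ {f} {f′} f≡f′))
  fill-cong h f≡f′ {suc i} i<d = f≡f′ i<d

  assign-cong : ∀ row {f f′} p → (∀ {i} → i < d → f (suc i) ≡ f′ (suc i)) →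
                Row.assign a r row f p ≡ Row.assign a r row f′ p
  assign-cong row@(b , s , _) {f} {f′} ((R , ν) , w) f≡f′ = cong₂ _,_
    (cong₂ _,_ (cong (R ∸_) (used-cong row f≡f′)) (cong (_++ ν) (items-cong b s (fill-cong height f≡f′))))
    (cong (_* w) (multi-cong g height (1⋯ d) (on1⋯ {f} {f′} f≡f′)))
    where open Row a r row

  AgreeOn : List Label → Family → Family → Set
  AgreeOn ls ν ν′ = ∀ {b s} → (b , s) ∈ ls → ∀ {k} → k ≤ d → ν b s k ≡ ν′ b s k

  res-cong : ∀ ls {ν ν′} → AgreeOn ls ν ν′ → res ls ν ≡ res ls ν′
  res-cong []       ν≡ν′ = refl
  res-cong (l ∷ ls) {ν} {ν′} ν≡ν′ rewrite res-cong ls {ν} {ν′} (ν≡ν′ ∘ there) =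
    assign-cong (rowOf l) (res ls ν′) (ν≡ν′ (here refl))

  ∑0⋯ : ∀ f → ∑ (0⋯ d) f ≡ f 0 + ∑ (1⋯ d) f
  ∑0⋯ f = cong (λ is → ∑ is f) (0⋯≡0∷1⋯ d)

  fill-fits : ∀ {b s f} → 1 ≤ b → Fits b s f → ∀ {k} → k ≤ d → fill (Row.height a r (rowOf (b , s))) f k ≡ f k
  fill-fits {b} {s} {f} b≥1 fits {zero} _ = trans
    (cong (_∸ ∑ (1⋯ d) f) (trans (height≡ s b≥1) (trans (sym (rowsum fits)) (∑0⋯ f))))
    (m+n∸n≡m (f 0) (∑ (1⋯ d) f))
  fill-fits b≥1 fits {suc i} _ = refl

  enc : List Label → Family → List ⟦ ItemTy ⟧
  enc ls ν = concatMap (λ (b , s) → items b s (ν b s)) ls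

  res-enc : ∀ ls {ν} → All ((1 ≤_) ∘ proj₁) ls → Good ls ν → proj₂ (proj₁ (res ls ν)) ≡ enc ls ν
  res-enc []             []          _               = refl
  res-enc ((b , s) ∷ ls) (b≥1 ∷ ls≥) (fits , _ , good) =
    cong₂ _++_ (items-cong b s (fill-fits b≥1 fits)) (res-enc ls ls≥ good)

  ∈-items⁻ : ∀ b s f {b′ s′ k c} → (b′ , s′ , k , c) ∈ items b s f → (b′ , s′) ≡ (b , s) × c ≡ f k
  ∈-items⁻ b s f x∈ with ∈-concatMap-find _ (0⋯ d) x∈
  ... | k , k∈ , x∈k with f k in eq
  ∈-items⁻ b s f x∈ | k , k∈ , here refl | suc c = refl , sym eq

  ∈-items⁺ : ∀ b s f {k} → k ≤ d → f k ≢ 0 → (b , s , k , f k) ∈ items b s f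
  ∈-items⁺ b s f {k} k≤d fk≢0 = ∈-concatMap⁺′ _ (0⋯ d) (∈-upTo⁺ (s≤s k≤d)) (lemma (f k) fk≢0)
    where
    lemma : ∀ c → c ≢ 0 → (b , s , k , c) ∈ ifz c [] [ (b , s , k , c) ]
    lemma zero    c≢0 = contradiction refl c≢0
    lemma (suc c) _   = here refl

  enc-agree : ∀ ls {ν ν′} → enc ls ν ≡ enc ls ν′ → ∀ {b s k} → (b , s) ∈ ls → k ≤ d → ν b s k ≢ 0 → ν b s k ≡ ν′ b s k
  enc-agree ls {ν} {ν′} eq {b} {s} {k} l∈ k≤d ≢0 with ∈-concatMap-find _ ls
    (subst ((b , s , k , ν b s k) ∈_) eq (∈-concatMap⁺′ _ ls l∈ (∈-items⁺ b s (ν b s) k≤d ≢0)))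
  ... | (b′ , s′) , _ , x∈ with ∈-items⁻ b′ s′ (ν′ b′ s′) x∈
  ...   | refl , e = e

  -- An item carries its own indices, so a nonzero entry of either family is found again among the
  -- items of the other. Entries where neither family is nonzero agree trivially, though they leave
  -- no trace in the code.
  enc-injective : ∀ ls {ν ν′} → enc ls ν ≡ enc ls ν′ → AgreeOn ls ν ν′
  enc-injective ls {ν} {ν′} eq {b} {s} l∈ {k} k≤d with ν b s k ≟ 0 | ν′ b s k ≟ 0
  ... | yes z | yes z′ = trans z (sym z′)
  ... | no ≢0 | _      = enc-agree ls {ν} {ν′} eq l∈ k≤d ≢0
  ... | yes z | no ≢0  = sym (enc-agree ls {ν′} {ν} (sym eq) l∈ k≤d ≢0)

  update : ℕ → ℕ → (ℕ → ℕ) → Family → Family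
  update b s f ν b′ s′ k = pick (≡-dec _≟_ _≟_ (b′ , s′) (b , s)) (f k) (ν b′ s′ k)

  update-hit : ∀ b s f ν k → update b s f ν b s k ≡ f k
  update-hit b s f ν k = pick-yes (≡-dec _≟_ _≟_ (b , s) (b , s)) refl

  update-miss : ∀ {b s b′ s′} f ν k → (b′ , s′) ≢ (b , s) → update b s f ν b′ s′ k ≡ ν b′ s′ k
  update-miss {b} {s} {b′} {s′} f ν k ne = pick-no (≡-dec _≟_ _≟_ (b′ , s′) (b , s)) ne

  -- Carried along the construction because `𝒜` requires a family to vanish outside its index set.
  Off : List Label → Family → Set
  Off ls ν = ∀ {b s} → (b , s) ∉ ls → ∀ k → ν b s k ≡ 0

  Good-cong : ∀ ls {ν ν′} → (∀ {b s} → (b , s) ∈ ls → ∀ k → ν b s k ≡ ν′ b s k) → Good ls ν → Good ls ν′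
  Good-cong []             ν≡ν′ _ = tt
  Good-cong ((b , s) ∷ ls) {ν} {ν′} ν≡ν′ (fits , used≤ , good) =
    record { rowsum = trans (∑-cong (0⋯ d) (λ {k} _ → sym (ν≡ν′ (here refl) k))) (rowsum fits)
           ; beyond = λ {k} K<k → trans (sym (ν≡ν′ (here refl) k)) (beyond fits K<k) } ,
    subst (_≤ residual (res ls ν′)) (used-cong (rowOf (b , s)) λ {i} _ → ν≡ν′ (here refl) (suc i))
      (subst (λ p → Row.used a r (rowOf (b , s)) (ν b s) ≤ residual p) (res-cong ls λ l∈ {k} _ → ν≡ν′ (there l∈) k) used≤) ,
    Good-cong ls (ν≡ν′ ∘ there) good

  module _ {b s : ℕ} (b≥1 : 1 ≤ b) {ls : List Label} (l∉ : (b , s) ∉ ls) {x : List ℕ} (x∈ : x ∈ words d d)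
           {ν : Family} (good : Good ls ν) (excess≡0 : Row.excess a r (rowOf (b , s)) (nth (0 ∷ x)) (residual (res ls ν)) ≡ 0) where
    private
      f = nth (0 ∷ x)
      row = rowOf (b , s)
      open Row a r row using (height; used)
      F = fill height f
      ν⁺ = update b s F ν

      hit : ∀ k → ν⁺ b s k ≡ F k
      hit = update-hit b s F ν

      old : ∀ {b′ s′} → (b′ , s′) ∈ ls → ∀ k → ν b′ s′ k ≡ ν⁺ b′ s′ k
      old l′∈ k = sym (update-miss F ν k λ { refl → l∉ l′∈ })

    res-update : res ((b , s) ∷ ls) ν⁺ ≡ Row.assign a r row f (res ls ν)
    res-update rewrite res-cong ls {ν⁺} {ν} (λ l∈ {k} _ → sym (old l∈ k)) =
      assign-cong row (res ls ν) λ {i} _ → hit (suc i)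

    Good-update : Good ((b , s) ∷ ls) ν⁺
    Good-update = record
      { rowsum = trans (∑-cong (0⋯ d) λ {k} _ → hit k) (trans (∑0⋯ F) (trans
          (cong (F 0 +_) (∑-cong (1⋯ d) {F} {f} (on1⋯ {F} {f} λ _ → refl)))
          (trans (m∸n+n≡m (excess≡0⇒≤height s b≥1 f (residual (res ls ν)) excess≡0)) (height≡ s b≥1))))
      ; beyond = λ {k} K<k → trans (hit k) (vanish k K<k) } ,
      subst (_≤ residual (res ls ν⁺)) (used-cong row λ {i} _ → sym (hit (suc i)))
        (subst (λ p → used f ≤ residual p) (res-cong ls λ l∈ {k} _ → old l∈ k)
          (Row.excess≡0⇒used≤ a r row f (residual (res ls ν)) excess≡0)) ,
      Good-cong ls old good
      where
      vanish : ∀ k → K a r b s < k → F k ≡ 0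
      vanish (suc i) K<k with i <? d
      ... | yes i<d = excess≡0⇒beyond s b≥1 f (residual (res ls ν)) excess≡0 i<d K<k
      -- Past the end of a word, which has length `d`, `nth` has the default value 0.
      ... | no  i≮d = nth-beyond x (≤-trans (≤-reflexive (length-word d d x∈)) (≮⇒≥ i≮d))

    Off-update : Off ls ν → Off ((b , s) ∷ ls) ν⁺
    Off-update off l∉′ k = trans (update-miss F ν k (l∉′ ∘ here)) (off (l∉′ ∘ there) k)

  module _ where
    open Row a r

    -- The family is rebuilt row by row with `update`; as the labels are distinct, no row overwrites
    -- one that was set before.
    enumerate-sound : ∀ ls → Unique ls → All ((1 ≤_) ∘ proj₁) ls → ∀ {p} → p ∈ enumerate a r (map rowOf ls) →
                      ∃[ ν ] Good ls ν × Off ls ν × p ≡ res ls ν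
    enumerate-sound []             _             _           (here refl) = (λ _ _ _ → 0) , tt , (λ _ _ → refl) , refl
    enumerate-sound ((b , s) ∷ ls) uniq@(l∉ ∷ uniqs) (b≥1 ∷ ls≥) p∈
      with ∈-concatMap-find (extend (rowOf (b , s))) (enumerate a r (map rowOf ls)) p∈
    ... | q , q∈ , p∈q with enumerate-sound ls uniqs ls≥ q∈ | ∈-extend⁻ (rowOf (b , s)) p∈q
    ...   | ν , good , off , refl | x , x∈ , e , refl =
      update b s _ ν , Good-update b≥1 ∉ls x∈ good e , Off-update b≥1 ∉ls x∈ good e off , sym (res-update b≥1 ∉ls x∈ good e)
      where ∉ls = Unique.Unique[x∷xs]⇒x∉xs uniq

    enumerate-complete : ∀ ls → All ((1 ≤_) ∘ proj₁) ls → ∀ ν → Good ls ν → res ls ν ∈ enumerate a r (map rowOf ls)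
    enumerate-complete []             _           ν _ = here refl
    enumerate-complete ((b , s) ∷ ls) (b≥1 ∷ ls≥) ν (fits , used≤ , good) =
      ∈-concatMap⁺′ (extend row) (enumerate a r (map rowOf ls)) (enumerate-complete ls ls≥ ν good)
        (∈-concatMap⁺′ _ (words d d) (∈-words⁺ d d _ λ i i<d → small i i<d)
          (subst (λ c → res ((b , s) ∷ ls) ν ∈ ifz c [ assign row f (res ls ν) ] []) (sym excess≡0)
            (here (assign-cong row (res ls ν) (sym ∘ agree)))))
      where
      row = rowOf (b , s)
      x = applyUpTo (ν b s ∘ suc) d
      f = nth (0 ∷ x)

      agree : ∀ {i} → i < d → f (suc i) ≡ ν b s (suc i)
      agree = nth-applyUpTo (ν b s ∘ suc) d

      -- A letter is at most the budget that it spends, hence at most `d`: the alphabet {0, ..., d}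
      -- is large enough.
      small : ∀ i → i < d → ν b s (suc i) ≤ d
      small i i<d = begin
        ν b s (suc i)                 ≤⟨ m≤m+n _ _ ⟩
        suc i * ν b s (suc i)         ≤⟨ ≤sum (λ k → k * ν b s k) (1⋯ d) (∈-1⋯⁺ i<d) ⟩
        dot (ν b s)                   ≤⟨ m≤m+n _ _ ⟩
        used row (ν b s)              ≤⟨ used≤ ⟩
        residual (res ls ν)           ≤⟨ residual-res≤d ls ν ⟩
        d                             ∎
        where open ≤-Reasoning

      excess≡0 : excess row f (residual (res ls ν)) ≡ 0
      excess≡0 = excess≡0⁺ s b≥1
        (≤-trans (≤-reflexive (∑-cong (1⋯ d) (on1⋯ {f} {ν b s} agree)))
          (≤-trans (m≤n+m _ (ν b s 0)) (≤-reflexive (trans (sym (∑0⋯ (ν b s))) (trans (rowsum fits) (sym (height≡ s b≥1)))))))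
        (subst (_≤ residual (res ls ν)) (used-cong row (sym ∘ agree)) used≤)
        beyond′
        where
        beyond′ : ∀ {k} → K a r b s < k → f k ≡ 0
        beyond′ {suc i} K<k with i <? d
        ... | yes i<d = trans (agree i<d) (beyond fits K<k)
        ... | no  i≮d = nth-beyond x (≤-trans (≤-reflexive (length-applyUpTo (ν b s ∘ suc) d)) (≮⇒≥ i≮d))

    -- If two extensions coincide, so do the codes of the families behind them. By `enc-injective`
    -- these families agree on all labels, which identifies both the earlier partial transitions and
    -- the chosen words.
    enumerate-unique : ∀ ls → Unique ls → All ((1 ≤_) ∘ proj₁) ls → Unique (enumerate a r (map rowOf ls))
    enumerate-unique []             _             _           = [] ∷ []
    enumerate-unique ((b , s) ∷ ls) uniq@(l∉ ∷ uniqs) (b≥1 ∷ ls≥) =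
      concatMap-unique (extend row) L (enumerate-unique ls uniqs ls≥)
        (λ {q} q∈ → concatMap-unique _ (words d d) (words-unique d d)
          (λ {x} _ → ifz-unique (excess row (nth (0 ∷ x)) (residual q)))
          λ {x} {x′} x∈ x′∈ p∈ p∈′ → let e , p≡ = ifz-∈ (excess row (nth (0 ∷ x)) (residual q)) p∈
                                         e′ , p≡′ = ifz-∈ (excess row (nth (0 ∷ x′)) (residual q)) p∈′ in
            proj₂ (same q∈ q∈ x∈ x′∈ e e′ (trans (sym p≡) p≡′)))
        λ {q} {q′} q∈ q∈′ p∈ p∈′ → let x , x∈ , e , p≡ = ∈-extend⁻ row p∈ ; x′ , x′∈ , e′ , p≡′ = ∈-extend⁻ row p∈′ in
          proj₁ (same q∈ q∈′ x∈ x′∈ e e′ (trans (sym p≡) p≡′))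
      where
      row = rowOf (b , s)
      L = enumerate a r (map rowOf ls)
      ∉ls = Unique.Unique[x∷xs]⇒x∉xs uniq

      ifz-unique : ∀ {X : Set} c {y : X} → Unique (ifz c [ y ] [])
      ifz-unique zero    = [] ∷ []
      ifz-unique (suc _) = []

      same : ∀ {q q′ x x′} → q ∈ L → q′ ∈ L → x ∈ words d d → x′ ∈ words d d →
             excess row (nth (0 ∷ x)) (residual q) ≡ 0 → excess row (nth (0 ∷ x′)) (residual q′) ≡ 0 →
             assign row (nth (0 ∷ x)) q ≡ assign row (nth (0 ∷ x′)) q′ → q ≡ q′ × x ≡ x′
      same {x = x} {x′} q∈ q′∈ x∈ x′∈ e e′ eq with enumerate-sound ls uniqs ls≥ q∈ | enumerate-sound ls uniqs ls≥ q′∈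
      ... | ν , good , _ , refl | ν′ , good′ , _ , refl =
        res-cong ls (λ {b′} {s′} l∈ {k} k≤d → begin
          ν b′ s′ k               ≡⟨ update-miss F ν k (λ { refl → ∉ls l∈ }) ⟨
          update b s F ν b′ s′ k  ≡⟨ agree (there l∈) k≤d ⟩
          update b s F′ ν′ b′ s′ k ≡⟨ update-miss F′ ν′ k (λ { refl → ∉ls l∈ }) ⟩
          ν′ b′ s′ k              ∎) ,
        nth-injective x x′ (trans (length-word d d x∈) (sym (length-word d d x′∈))) λ {i} i<len →
          trans (sym (update-hit b s F ν (suc i)))
            (trans (agree (here refl) (≤-trans i<len (≤-reflexive (length-word d d x∈)))) (update-hit b s F′ ν′ (suc i)))
        where
        open ≡-Reasoning
        F = fill (height row) (nth (0 ∷ x))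
        F′ = fill (height row) (nth (0 ∷ x′))
        encs : enc ((b , s) ∷ ls) (update b s F ν) ≡ enc ((b , s) ∷ ls) (update b s F′ ν′)
        encs = begin
          enc ((b , s) ∷ ls) (update b s F ν)                        ≡⟨ res-enc ((b , s) ∷ ls) (b≥1 ∷ ls≥) (Good-update b≥1 ∉ls x∈ good e) ⟨
          proj₂ (proj₁ (res ((b , s) ∷ ls) (update b s F ν)))        ≡⟨ cong (proj₂ ∘ proj₁) (trans (res-update b≥1 ∉ls x∈ good e)
                                                             (trans eq (sym (res-update b≥1 ∉ls x′∈ good′ e′)))) ⟩
          proj₂ (proj₁ (res ((b , s) ∷ ls) (update b s F′ ν′)))      ≡⟨ res-enc ((b , s) ∷ ls) (b≥1 ∷ ls≥) (Good-update b≥1 ∉ls x′∈ good′ e′) ⟩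
          enc ((b , s) ∷ ls) (update b s F′ ν′)                      ∎
        agree : AgreeOn ((b , s) ∷ ls) (update b s F ν) (update b s F′ ν′)
        agree = enc-injective ((b , s) ∷ ls) encs

-- Transitions and their codes

applyUpTo-++ : ∀ {X : Set} (f : ℕ → X) m n → applyUpTo f (m + n) ≡ applyUpTo f m ++ applyUpTo (λ i → f (m + i)) n
applyUpTo-++ f zero    n = refl
applyUpTo-++ f (suc m) n = cong (f 0 ∷_) (applyUpTo-++ (f ∘ suc) m n)

0⋯-split : ∀ {k n} → k ≤ n → ∃[ js ] 0⋯ n ≡ 0⋯ k ++ js × (∀ {j} → j ∈ js → k < j)
0⋯-split {k} {n} k≤n = applyUpTo (λ i → suc k + i) (n ∸ k) ,
  trans (cong upTo (sym (cong suc (m+[n∸m]≡n k≤n)))) (applyUpTo-++ id (suc k) (n ∸ k)) ,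
  λ j∈ → let i , _ , j≡ = ∈-applyUpTo⁻ (λ i → suc k + i) j∈ in subst (k <_) (sym j≡) (s≤s (m≤m+n k i))

∏-cong : ∀ is {f g : ℕ → ℕ} → (∀ {i} → i ∈ is → f i ≡ g i) → ∏ is f ≡ ∏ is g
∏-cong []       f≡g = refl
∏-cong (i ∷ is) f≡g = cong₂ _*_ (f≡g (here refl)) (∏-cong is (f≡g ∘ there))

∏1 : ∀ is {f : ℕ → ℕ} → (∀ {i} → i ∈ is → f i ≡ 1) → ∏ is f ≡ 1
∏1 []       f≡1 = refl
∏1 (i ∷ is) f≡1 = cong₂ _*_ (f≡1 (here refl)) (∏1 is (f≡1 ∘ there))

∑-extend : ∀ {k n} (f : ℕ → ℕ) → k ≤ n → (∀ {j} → k < j → f j ≡ 0) → ∑ (0⋯ k) f ≡ ∑ (0⋯ n) f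
∑-extend {k} {n} f k≤n f≡0 with 0⋯-split k≤n
... | js , eq , k<j = sym (begin
  ∑ (0⋯ n) f             ≡⟨ cong (λ is → ∑ is f) eq ⟩
  ∑ (0⋯ k ++ js) f       ≡⟨ cong sum (map-++ f (0⋯ k) js) ⟩
  sum (map f (0⋯ k) ++ map f js) ≡⟨ sum-++ (map f (0⋯ k)) (map f js) ⟩
  ∑ (0⋯ k) f + ∑ js f    ≡⟨ cong (∑ (0⋯ k) f +_) (trans (∑-cong js {g = λ _ → 0} (f≡0 ∘ k<j)) (∑0 js λ _ → refl)) ⟩
  ∑ (0⋯ k) f + 0         ≡⟨ +-identityʳ _ ⟩
  ∑ (0⋯ k) f             ∎)
  where open ≡-Reasoning

∏-extend : ∀ {k n} (f : ℕ → ℕ) → k ≤ n → (∀ {j} → k < j → f j ≡ 1) → ∏ (0⋯ k) f ≡ ∏ (0⋯ n) f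
∏-extend {k} {n} f k≤n f≡1 with 0⋯-split k≤n
... | js , eq , k<j = sym (begin
  ∏ (0⋯ n) f             ≡⟨ cong (λ is → ∏ is f) eq ⟩
  ∏ (0⋯ k ++ js) f       ≡⟨ cong product (map-++ f (0⋯ k) js) ⟩
  product (map f (0⋯ k) ++ map f js) ≡⟨ product-++ (map f (0⋯ k)) (map f js) ⟩
  ∏ (0⋯ k) f * ∏ js f    ≡⟨ cong (∏ (0⋯ k) f *_) (∏1 js (f≡1 ∘ k<j)) ⟩
  ∏ (0⋯ k) f * 1         ≡⟨ *-identityʳ _ ⟩
  ∏ (0⋯ k) f             ∎)
  where open ≡-Reasoning

∑-*ˡ : ∀ c is (f : ℕ → ℕ) → c * ∑ is f ≡ ∑ is (λ i → c * f i)
∑-*ˡ c []       f = *-zeroʳ c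
∑-*ˡ c (i ∷ is) f = trans (*-distribˡ-+ c (f i) _) (cong (c * f i +_) (∑-*ˡ c is f))

grid : List ℕ → List ℕ → List (ℕ × ℕ)
grid bs ss = concatMap (λ b → map (b ,_) ss) bs

∑-grid : ∀ bs ss (F : ℕ × ℕ → ℕ) → sum (map F (grid bs ss)) ≡ ∑ bs λ b → ∑ ss λ s → F (b , s)
∑-grid []       ss F = refl
∑-grid (b ∷ bs) ss F = trans (cong sum (map-++ F (map (b ,_) ss) (grid bs ss)))
  (trans (sum-++ (map F (map (b ,_) ss)) _) (cong₂ _+_ (cong sum (sym (map-∘ ss))) (∑-grid bs ss F)))

∏-grid : ∀ bs ss (F : ℕ × ℕ → ℕ) → product (map F (grid bs ss)) ≡ ∏ bs λ b → ∏ ss λ s → F (b , s)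
∏-grid []       ss F = refl
∏-grid (b ∷ bs) ss F = trans (cong product (map-++ F (map (b ,_) ss) (grid bs ss)))
  (trans (product-++ (map F (map (b ,_) ss)) _) (cong₂ _*_ (cong product (sym (map-∘ ss))) (∏-grid bs ss F)))

concatMap-grid : ∀ {X : Set} bs ss (F : ℕ × ℕ → List X) → concatMap F (grid bs ss) ≡ concatMap (λ b → concatMap (λ s → F (b , s)) ss) bs
concatMap-grid []       ss F = refl
concatMap-grid (b ∷ bs) ss F = trans (go ss) (cong (concatMap (λ s → F (b , s)) ss ++_) (concatMap-grid bs ss F))
  where
  go : ∀ ts → concatMap F (map (b ,_) ts ++ grid bs ss) ≡ concatMap (λ s → F (b , s)) ts ++ concatMap F (grid bs ss)
  go []       = refl
  go (s ∷ ts) = trans (cong (F (b , s) ++_) (go ts)) (sym (++-assoc (F (b , s)) _ _))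

filter-concatMap : ∀ {X Y : Set} {Q : Y → Set} (Q? : ∀ y → Dec (Q y)) (f : X → List Y) xs →
                   filter Q? (concatMap f xs) ≡ concatMap (filter Q? ∘ f) xs
filter-concatMap Q? f []       = refl
filter-concatMap Q? f (x ∷ xs) = trans (filter-++ Q? (f x) (concatMap f xs)) (cong (filter Q? (f x) ++_) (filter-concatMap Q? f xs))

lookup-unique : ∀ {X : Set} {xs : List X} → Unique xs → ∀ {i j} → lookup xs i ≡ lookup xs j → i ≡ j
lookup-unique (x∉ ∷ _) {Fin.zero}  {Fin.zero}  _ = refl
lookup-unique (x∉ ∷ _) {Fin.zero}  {Fin.suc j} e = contradiction e (All.lookup x∉ (∈-lookup j))
lookup-unique (x∉ ∷ _) {Fin.suc i} {Fin.zero}  e = contradiction (sym e) (All.lookup x∉ (∈-lookup i))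
lookup-unique (_ ∷ u)  {Fin.suc i} {Fin.suc j} e = cong Fin.suc (lookup-unique u e)

module _ (S : Setoid 0ℓ 0ℓ) {X : Set} (code : Setoid.Carrier S → X) (out : List X) where
  open Setoid S using (Carrier; _≈_)

  -- The membership proofs are the bijection: `index` gives the position of a code, and the witness
  -- for the item at a position gives its preimage.
  codes⇒cardinality : (∀ {τ σ} → τ ≈ σ → code τ ≡ code σ) → (∀ {τ σ} → code τ ≡ code σ → τ ≈ σ) →
    Unique out → (∀ x → x ∈ out ⇔ (∃[ τ ] x ≡ code τ)) → HasCardinality S (length out)
  codes⇒cardinality code-cong code-injective unique codes = record
    { to        = position
    ; from      = λ i → proj₁ (decode i)
    ; to-cong   = λ {τ} {σ} τ≈σ → lookup-unique unique (trans (lookup-position τ) (trans (code-cong τ≈σ) (sym (lookup-position σ))))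
    ; from-cong = λ { refl → Setoid.refl S }
    ; inverse   = (λ {i} {τ} τ≈ → lookup-unique unique (trans (lookup-position τ) (trans (code-cong τ≈) (sym (proj₂ (decode i))))))
                , λ {τ} {i} i≡ → code-injective (trans (sym (proj₂ (decode i))) (trans (cong (lookup out) i≡) (lookup-position τ)))
    }
    where
    member : ∀ τ → code τ ∈ out
    member τ = Equivalence.from (codes (code τ)) (τ , refl)

    position : Carrier → Fin (length out)
    position τ = index (member τ)

    lookup-position : ∀ τ → lookup out (position τ) ≡ code τ
    lookup-position τ = sym (lookup-index (member τ))

    decode : ∀ i → ∃[ τ ] lookup out i ≡ code τ
    decode i = Equivalence.to (codes (lookup out i)) (∈-lookup i)

-- Multinomial coefficients as products of binomials

nCk*k![n∸k]!≡n! : ∀ {n k} → k ≤ n → (n C k) * (k ! * (n ∸ k) !) ≡ n !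
nCk*k![n∸k]!≡n! {n} {k} k≤n = trans (cong (_* (k ! * (n ∸ k) !)) (nCk≡n!/k![n-k]! k≤n))
  (m/n*n≡m ⦃ k !* (n ∸ k) !≢0 ⦄ (k![n∸k]!∣n! k≤n))

m*n-div-n : ∀ m {n} → 1 ≤ n → (m * n) div n ≡ m
m*n-div-n m {suc n} _ = m*n/n≡m m (suc n)

∏!≥1 : ∀ is (f : ℕ → ℕ) → 1 ≤ ∏ is (λ k → f k !)
∏!≥1 []       f = s≤s z≤n
∏!≥1 (i ∷ is) f = *-mono-≤ (1≤n! (f i)) (∏!≥1 is f)

binomials : (ℕ → ℕ) → ℕ → List ℕ → ℕ
binomials f h []       = 1
binomials f h (k ∷ ks) = (h C f k) * binomials f (h ∸ f k) ks

-- The factorials of successive remainders telescope. In the product form no division occurs until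
-- the quotient in `W` is cancelled.
binomials-! : ∀ f h ks → ∑ ks f ≤ h → binomials f h ks * ((h ∸ ∑ ks f) ! * ∏ ks (λ k → f k !)) ≡ h !
binomials-! f h []       _  = trans (+-identityʳ _) (*-identityʳ (h !))
binomials-! f h (k ∷ ks) ≤h = begin
  (h C f k) * B * ((h ∸ (f k + ∑ ks f)) ! * (f k ! * F))  ≡⟨ cong (λ m → (h C f k) * B * (m ! * (f k ! * F))) (sym (∸-+-assoc h (f k) _)) ⟩
  (h C f k) * B * (R * (f k ! * F))                       ≡⟨ shuffle (h C f k) B R (f k !) F ⟩
  (h C f k) * (f k ! * (B * (R * F)))                     ≡⟨ cong (λ m → (h C f k) * (f k ! * m)) (binomials-! f (h ∸ f k) ks
                                                                (m+n≤o⇒m≤o∸n (∑ ks f) (≤-trans (≤-reflexive (+-comm _ (f k))) ≤h))) ⟩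
  (h C f k) * (f k ! * (h ∸ f k) !)                       ≡⟨ nCk*k![n∸k]!≡n! (m+n≤o⇒m≤o (f k) ≤h) ⟩
  h !                                                     ∎
  where
  open ≡-Reasoning
  B = binomials f (h ∸ f k) ks
  F = ∏ ks (λ k → f k !)
  R = (h ∸ f k ∸ ∑ ks f) !
  open +-*-Solver
  shuffle : ∀ c b r x f → c * b * (r * (x * f)) ≡ c * (x * (b * (r * f)))
  shuffle = solve 5 (λ c b r x f → c :* b :* (r :* (x :* f)) := c :* (x :* (b :* (r :* f)))) refl

multi≡binomials : ∀ f g h ks → multi f g h ks ≡ binomials f h ks * ∏ ks (λ k → (g C k) ^ f k)
multi≡binomials f g h []       = refl
multi≡binomials f g h (k ∷ ks) = trans (cong ((h C f k) * (g C k) ^ f k *_) (multi≡binomials f g (h ∸ f k) ks))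
  (shuffle (h C f k) ((g C k) ^ f k) (binomials f (h ∸ f k) ks) (∏ ks (λ k → (g C k) ^ f k)))
  where
  open +-*-Solver using (solve; _:*_; _:=_)
  shuffle : ∀ x y z w → x * y * (z * w) ≡ x * z * (y * w)
  shuffle = solve 4 (λ x y z w → x :* y :* (z :* w) := x :* z :* (y :* w)) refl

^-distribʳ-* : ∀ k m n → (m * n) ^ k ≡ m ^ k * n ^ k
^-distribʳ-* zero    m n = refl
^-distribʳ-* (suc k) m n = trans (cong (m * n *_) (^-distribʳ-* k m n)) (shuffle m n (m ^ k) (n ^ k))
  where
  open +-*-Solver using (solve; _:*_; _:=_)
  shuffle : ∀ m n x y → m * n * (x * y) ≡ m * x * (n * y)
  shuffle = solve 4 (λ m n x y → m :* n :* (x :* y) := m :* x :* (n :* y)) refl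

-- Rows with entry zero and the final factor

zeros : ∀ d k → nth (0 ∷ replicate d 0) k ≡ 0
zeros d zero    = refl
zeros d (suc k) = nth-replicate d k

module _ (d : ℕ) where
  open Enumeration d

  -- A row with entry 0 has height 0, so only the zero word fits, and it changes nothing. Hence the
  -- enumeration over the stored nonzero entries equals the one over the full grid of labels.
  extend-zero : ∀ a r b s p → Row.extend a r (b , s , 0) p ≡ [ p ]
  extend-zero a r b s p@((R , ν) , w) with words d d | words-zero∷ d d
  ... | _ | ws , refl , pos = cong₂ _++_ first (concatMap-[] ws (others ∘ pos))
    where
    open Row a r (b , s , 0)
    f = nth (0 ∷ replicate d 0)

    height≡0 : height ≡ 0
    height≡0 with (b ∸ a) + (a ∸ b) + ((s ∸ r) + (r ∸ s))
    ... | zero  = refl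
    ... | suc _ = refl

    used≡0 : used f ≡ 0
    used≡0 = trans (cong (α′ *_) (∑0 (1⋯ d) λ k → trans (cong (k *_) (zeros d k)) (*-zeroʳ k))) (*-zeroʳ α′)

    excess≡0 : excess f R ≡ 0
    excess≡0 = cong₂ _+_ (cong₂ _+_ (trans (cong (_∸ height) (∑0 (1⋯ d) (zeros d))) (0∸n≡0 height))
                                    (trans (cong (_∸ R) used≡0) (0∸n≡0 R)))
                         (∑0 (1⋯ d) λ k → cong (_* ((k ∸ g) + (k ∸ quot r α′) + (k ∸ quot s β′))) (zeros d k))

    fill≡0 : ∀ k → fill height f k ≡ 0
    fill≡0 zero    = trans (cong (_∸ ∑ (1⋯ d) f) height≡0) (0∸n≡0 (∑ (1⋯ d) f))
    fill≡0 (suc k) = zeros d (suc k)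

    assign≡ : assign f p ≡ p
    assign≡ = cong₂ _,_
      (cong₂ _,_ (cong (R ∸_) used≡0)
        (cong (_++ ν) (concatMap-[] (0⋯ d) λ {k} _ → cong (λ c → ifz c [] [ (b , s , k , c) ]) (fill≡0 k))))
      (trans (cong (_* w) (multi≡1 f g height (1⋯ d) λ {k} _ → zeros d k)) (+-identityʳ w))

    first : ifz (excess f R) [ assign f p ] [] ≡ [ p ]
    first rewrite excess≡0 = cong [_] assign≡

    others : ∀ {x} → (∃[ i ] i < d × 0 < nth x i) → ifz (excess (nth (0 ∷ x)) R) [ assign (nth (0 ∷ x)) p ] [] ≡ []
    others {x} (i , i<d , pos) with excess (nth (0 ∷ x)) R in eq
    ... | suc _ = refl
    ... | zero  = contradiction
      (∑≡0⇒≡0 (1⋯ d) (nth (0 ∷ x)) (n≤0⇒n≡0 (≤-trans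
        (m∸n≡0⇒m≤n {∑ (1⋯ d) (nth (0 ∷ x))} {height} (m+n≡0⇒m≡0 _ (m+n≡0⇒m≡0 (∑ (1⋯ d) (nth (0 ∷ x)) ∸ height + (used (nth (0 ∷ x)) ∸ R)) eq)))
        (≤-reflexive height≡0))) (∈-1⋯⁺ i<d))
      (m<n⇒n≢0 pos)

  nonzero? : (row : ⟦ RowTy ⟧) → Dec (¬ (proj₂ (proj₂ row) ≡ 0))
  nonzero? (_ , _ , c) = ¬? (c ≟ 0)

  enumerate-filter : ∀ a r rows → enumerate a r (filter nonzero? rows) ≡ enumerate a r rows
  enumerate-filter a r []                  = refl
  enumerate-filter a r ((b , s , zero) ∷ rows) = trans (enumerate-filter a r rows) (sym (concatMap-id (enumerate a r rows)))
    where
    concatMap-id : ∀ L → concatMap (Row.extend a r (b , s , 0)) L ≡ L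
    concatMap-id []      = refl
    concatMap-id (p ∷ L) = cong₂ _++_ (extend-zero a r b s p) (concatMap-id L)
  enumerate-filter a r (row@(_ , _ , suc _) ∷ rows) = cong (concatMap (Row.extend a r row)) (enumerate-filter a r rows)

  result : ℕ → ⟦ PartialTy ⟧ → ⟦ PartialTy ⟧
  result a (x@(R , _) , w) = x , I a R * w

  finish≡ : ∀ a p → residual p ≤ d → finish a p ≡ [ result a p ]
  finish≡ a p@((R , ν) , w) R≤d with 0⋯-split R≤d
  ... | js , eq , R<j = begin
    concatMap F (0⋯ d)                       ≡⟨ cong (concatMap F) eq ⟩
    concatMap F (0⋯ R ++ js)                 ≡⟨ concatMap-++ F (0⋯ R) js ⟩
    concatMap F (0⋯ R) ++ concatMap F js     ≡⟨ cong (concatMap F (0⋯ R) ++_) (concatMap-[] js λ {u} u∈ → miss u (>⇒≢ (R<j u∈))) ⟩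
    concatMap F (0⋯ R) ++ []                 ≡⟨ ++-identityʳ _ ⟩
    concatMap F (upTo (suc R))               ≡⟨ cong (concatMap F) (sym (applyUpTo-∷ʳ id R)) ⟩
    concatMap F (upTo R ++ [ R ])            ≡⟨ concatMap-++ F (upTo R) [ R ] ⟩
    concatMap F (upTo R) ++ (F R ++ [])      ≡⟨ cong₂ _++_ (concatMap-[] (upTo R) λ {u} u∈ → miss u (<⇒≢ (∈-upTo⁻ u∈))) (trans (++-identityʳ _) hit) ⟩
    [ result a p ]                           ∎
    where
    open ≡-Reasoning
    F : ℕ → List ⟦ PartialTy ⟧
    F u = ifz ((R ∸ u) + (u ∸ R)) [ ((R , ν) , I a u * w) ] []

    hit : F R ≡ [ result a p ]
    hit rewrite n∸n≡0 R = refl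

    miss : ∀ u → u ≢ R → F u ≡ []
    miss u u≢R with (R ∸ u) + (u ∸ R) in e
    ... | suc _ = refl
    ... | zero  = contradiction (≤-antisym (m∸n≡0⇒m≤n (m+n≡0⇒n≡0 (R ∸ u) e)) (m∸n≡0⇒m≤n (m+n≡0⇒m≡0 (R ∸ u) e))) u≢R

-- The bijection between transitions and items of the output

module Bijection {d : ℕ} (H : State d) (a r : ℕ) (pivot : 0 < entry H a r) where
  open Enumeration d
  open Correctness H a r pivot
  open Fits

  labels : List Label
  labels = grid (1⋯ (bound H)) (1⋯ d)

  ∈-labels⁺ : ∀ {b s} → 1 ≤ b → b ≤ bound H → 1 ≤ s → s ≤ d → (b , s) ∈ labels
  ∈-labels⁺ {suc b} {suc s} _ b≤ _ s≤ = ∈-concatMap⁺′ (λ b → map (b ,_) (1⋯ d)) (1⋯ (bound H)) (∈-1⋯⁺ b≤) (∈-map⁺ (suc b ,_) (∈-1⋯⁺ s≤))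

  ∈-labels⁻ : ∀ {b s} → (b , s) ∈ labels → (1 ≤ b × b ≤ bound H) × (1 ≤ s × s ≤ d)
  ∈-labels⁻ l∈ with ∈-concatMap-find (λ b → map (b ,_) (1⋯ d)) (1⋯ (bound H)) l∈
  ... | b , b∈ , l∈b with ∈-map⁻ (b ,_) l∈b
  ...   | s , s∈ , refl = ∈-1⋯⁻ b∈ , ∈-1⋯⁻ s∈

  label? : ∀ l → Dec (l ∈ labels)
  label? l = _∈?_ (≡-dec _≟_ _≟_) l labels

  labels-unique : Unique labels
  labels-unique = concatMap-unique (λ b → map (b ,_) (1⋯ d)) (1⋯ (bound H)) (1⋯-unique (bound H))
    (λ _ → Unique.map⁺ (cong proj₂) (1⋯-unique d))
    λ {b} {b′} _ _ l∈ l∈′ → let _ , _ , e = ∈-map⁻ (b ,_) l∈ ; _ , _ , e′ = ∈-map⁻ (b′ ,_) l∈′ in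
      trans (sym (cong proj₁ e)) (cong proj₁ e′)

  labels≥1 : All ((1 ≤_) ∘ proj₁) labels
  labels≥1 = All.tabulate λ l∈ → proj₁ (proj₁ (∈-labels⁻ l∈))

  encodeState≡ : encodeState H ≡ filter (nonzero? d) (map rowOf labels)
  encodeState≡ = cong (filter (nonzero? d)) (sym (trans
    (map-concatMap rowOf (λ b → map (b ,_) (1⋯ d)) (1⋯ (bound H)))
    (concatMap-cong (λ b → sym (map-∘ (1⋯ d))) (1⋯ (bound H)))))

  L : List ⟦ PartialTy ⟧
  L = enumerate a r (encodeState H)

  L≡ : L ≡ enumerate a r (map rowOf labels)
  L≡ = trans (cong (enumerate a r) encodeState≡) (enumerate-filter d a r (map rowOf labels))

  usedAt : Family → Label → ℕ
  usedAt ν l = Row.used a r (rowOf l) (ν (proj₁ l) (proj₂ l))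

  multiAt : Family → Label → ℕ
  multiAt ν l = multi (ν (proj₁ l) (proj₂ l)) (Row.g a r (rowOf l)) (Row.height a r (rowOf l)) (1⋯ d)

  -- Successive truncated subtractions combine into one, and the initial budget min d r is `r` since
  -- the pivot has r ≤ d.
  residual-res : ∀ ls ν → residual (res ls ν) ≡ r ∸ sum (map (usedAt ν) ls)
  residual-res []       ν = m∸[m∸n]≡n r≤d
  residual-res (l ∷ ls) ν = trans (cong (_∸ usedAt ν l) (residual-res ls ν))
    (trans (∸-+-assoc r (sum (map (usedAt ν) ls)) (usedAt ν l)) (cong (r ∸_) (+-comm (sum (map (usedAt ν) ls)) (usedAt ν l))))

  weight-res : ∀ ls ν → proj₂ (res ls ν) ≡ product (map (multiAt ν) ls)
  weight-res []       ν = refl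
  weight-res (l ∷ ls) ν = cong (multiAt ν l *_) (weight-res ls ν)

  Good⇒Fits : ∀ ls {ν} → Good ls ν → ∀ {b s} → (b , s) ∈ ls → Fits b s (ν b s)
  Good⇒Fits (l ∷ ls) (fits , _ , _)  (here refl) = fits
  Good⇒Fits (l ∷ ls) (_ , _ , good)  (there l∈)  = Good⇒Fits ls good l∈

  Good⇒used≤ : ∀ ls {ν} → Good ls ν → sum (map (usedAt ν) ls) ≤ r
  Good⇒used≤ []       _ = z≤n
  Good⇒used≤ (l ∷ ls) {ν} (_ , used≤ , good) = m≤o∸n⇒m+n≤o (usedAt ν l) (Good⇒used≤ ls good)
    (≤-trans used≤ (≤-reflexive (residual-res ls ν)))

  -- Together with `Good⇒used≤`: checking the budget at every row amounts to one bound on the sum,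
  -- which is what `total` provides.
  Good⁺ : ∀ ls {ν} → (∀ {b s} → (b , s) ∈ ls → Fits b s (ν b s)) → sum (map (usedAt ν) ls) ≤ r → Good ls ν
  Good⁺ []       _    _     = tt
  Good⁺ (l ∷ ls) {ν} fits used≤ = fits (here refl) ,
    ≤-trans (m+n≤o⇒m≤o∸n (usedAt ν l) used≤) (≤-reflexive (sym (residual-res ls ν))) ,
    Good⁺ ls (fits ∘ there) (≤-trans (m≤n+m _ (usedAt ν l)) used≤)

  module _ {b s : ℕ} (b≥1 : 1 ≤ b) {f : ℕ → ℕ} (fits : Fits b s f) where
    private
      k₀ = K a r b s
      h₀ = h H a r b s
      g₀ = gcd a b
      row = rowOf (b , s)

    used≡ : Row.used a r row f ≡ ∑ (0⋯ k₀) (λ k → k * α a b * f k)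
    used≡ = begin
      Row.α′ a r row * dot f                         ≡⟨ cong (_* dot f) (α≡ s b≥1) ⟩
      α a b * dot f                                  ≡⟨ ∑-*ˡ (α a b) (1⋯ d) _ ⟩
      ∑ (1⋯ d) (λ k → α a b * (k * f k))             ≡⟨ ∑-cong (1⋯ d) (λ {k} _ → shuffle (α a b) k (f k)) ⟩
      ∑ (1⋯ d) (λ k → k * α a b * f k)               ≡⟨ ∑0⋯ (λ k → k * α a b * f k) ⟨
      ∑ (0⋯ d) (λ k → k * α a b * f k)               ≡⟨ ∑-extend _ (K≤d s b≥1) (λ {k} K<k → trans (cong (k * α a b *_) (beyond fits K<k)) (*-zeroʳ (k * α a b))) ⟨
      ∑ (0⋯ k₀) (λ k → k * α a b * f k)              ∎
      where
      open ≡-Reasoning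
      open +-*-Solver using (solve; _:*_; _:=_)
      shuffle : ∀ x k y → x * (k * y) ≡ k * x * y
      shuffle = solve 3 (λ x k y → x :* (k :* y) := k :* x :* y) refl

    rowsum-K : ∑ (0⋯ k₀) f ≡ h₀
    rowsum-K = trans (∑-extend f (K≤d s b≥1) (beyond fits)) (rowsum fits)

    multi≡W : multi f (Row.g a r row) (Row.height a r row) (1⋯ d) ≡
              (h₀ ! div ∏ (0⋯ k₀) (λ k → f k !)) * ∏ (0⋯ k₀) (λ k → (g₀ C k) ^ f k)
    multi≡W = begin
      multi f (Row.g a r row) (Row.height a r row) (1⋯ d)
        ≡⟨ cong₂ (λ g h → multi f g h (1⋯ d)) (g≡ s b≥1) (height≡ s b≥1) ⟩
      multi f g₀ h₀ (1⋯ d)              ≡⟨ multi≡binomials f g₀ h₀ (1⋯ d) ⟩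
      binomials f h₀ (1⋯ d) * ∏ (1⋯ d) (λ k → (g₀ C k) ^ f k) ≡⟨ cong₂ _*_ (sym quotient) (sym powers) ⟩
      (h₀ ! div ∏ (0⋯ k₀) (λ k → f k !)) * ∏ (0⋯ k₀) (λ k → (g₀ C k) ^ f k) ∎
      where
      open ≡-Reasoning
      h≡ : h₀ ≡ f 0 + ∑ (1⋯ d) f
      h≡ = trans (sym (rowsum fits)) (∑0⋯ f)

      powers : ∏ (0⋯ k₀) (λ k → (g₀ C k) ^ f k) ≡ ∏ (1⋯ d) (λ k → (g₀ C k) ^ f k)
      powers = begin
        ∏ (0⋯ k₀) (λ k → (g₀ C k) ^ f k)  ≡⟨ ∏-extend _ (K≤d s b≥1) (λ {k} K<k → cong ((g₀ C k) ^_) (beyond fits K<k)) ⟩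
        ∏ (0⋯ d) (λ k → (g₀ C k) ^ f k)   ≡⟨ cong (λ ks → ∏ ks (λ k → (g₀ C k) ^ f k)) (0⋯≡0∷1⋯ d) ⟩
        (g₀ C 0) ^ f 0 * ∏ (1⋯ d) (λ k → (g₀ C k) ^ f k) ≡⟨ cong (λ x → x ^ f 0 * ∏ (1⋯ d) (λ k → (g₀ C k) ^ f k)) (nC0≡1 g₀) ⟩
        1 ^ f 0 * ∏ (1⋯ d) (λ k → (g₀ C k) ^ f k) ≡⟨ cong (_* ∏ (1⋯ d) (λ k → (g₀ C k) ^ f k)) (^-zeroˡ (f 0)) ⟩
        1 * ∏ (1⋯ d) (λ k → (g₀ C k) ^ f k)  ≡⟨ *-identityˡ _ ⟩
        ∏ (1⋯ d) (λ k → (g₀ C k) ^ f k)   ∎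

      quotient : h₀ ! div ∏ (0⋯ k₀) (λ k → f k !) ≡ binomials f h₀ (1⋯ d)
      quotient = begin
        h₀ ! div ∏ (0⋯ k₀) (λ k → f k !)
          ≡⟨ cong (h₀ ! div_) (∏-extend _ (K≤d s b≥1) (λ K<k → cong _! (beyond fits K<k))) ⟩
        h₀ ! div D                          ≡⟨ cong (_div D) (trans (sym (binomials-! f h₀ (1⋯ d) (≤-trans (m≤n+m _ (f 0)) (≤-reflexive (sym h≡)))))
                                                  (cong (binomials f h₀ (1⋯ d) *_) (sym D≡))) ⟩
        (binomials f h₀ (1⋯ d) * D) div D   ≡⟨ m*n-div-n _ (∏!≥1 (0⋯ d) f) ⟩
        binomials f h₀ (1⋯ d)               ∎
        where
        D = ∏ (0⋯ d) (λ k → f k !)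
        -- The factor of `D` at k = 0 is the factorial of the last remainder in `binomials-!`.
        D≡ : D ≡ (h₀ ∸ ∑ (1⋯ d) f) ! * ∏ (1⋯ d) (λ k → f k !)
        D≡ = trans (cong (λ ks → ∏ ks (λ k → f k !)) (0⋯≡0∷1⋯ d))
          (cong (λ m → m ! * ∏ (1⋯ d) (λ k → f k !)) (sym (trans (cong (_∸ ∑ (1⋯ d) f) h≡) (m+n∸n≡m (f 0) (∑ (1⋯ d) f)))))

    items≡ : filter (λ (_ , _ , _ , c) → ¬? (c ≟ 0)) (map (λ k → b , s , k , f k) (0⋯ k₀)) ≡ items b s f
    items≡ with 0⋯-split (K≤d s b≥1)
    ... | js , eq , K<j = begin
      filter (λ (_ , _ , _ , c) → ¬? (c ≟ 0)) (map (λ k → b , s , k , f k) (0⋯ k₀)) ≡⟨ go (0⋯ k₀) ⟩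
      concatMap G (0⋯ k₀)                            ≡⟨ ++-identityʳ _ ⟨
      concatMap G (0⋯ k₀) ++ []                      ≡⟨ cong (concatMap G (0⋯ k₀) ++_) (concatMap-[] js λ {k} k∈ → cong (λ c → ifz c [] [ (b , s , k , c) ]) (beyond fits (K<j k∈))) ⟨
      concatMap G (0⋯ k₀) ++ concatMap G js          ≡⟨ concatMap-++ G (0⋯ k₀) js ⟨
      concatMap G (0⋯ k₀ ++ js)                      ≡⟨ cong (concatMap G) eq ⟨
      concatMap G (0⋯ d)                             ∎
      where
      open ≡-Reasoning
      G : ℕ → List ⟦ ItemTy ⟧
      G k = ifz (f k) [] [ (b , s , k , f k) ]
      go : ∀ ks → filter (λ (_ , _ , _ , c) → ¬? (c ≟ 0)) (map (λ k → b , s , k , f k) ks) ≡ concatMap G ks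
      go []       = refl
      go (k ∷ ks) with f k
      ... | zero  = go ks
      ... | suc c = cong (_ ∷_) (go ks)

  module _ {ν : Family} (fits : ∀ {b s} → (b , s) ∈ labels → Fits b s (ν b s)) where
    private
      at : ∀ {b s} → b ∈ 1⋯ (bound H) → s ∈ 1⋯ d → (b , s) ∈ labels
      at b∈ s∈ = let b≥1 , b≤ = ∈-1⋯⁻ b∈ ; s≥1 , s≤ = ∈-1⋯⁻ s∈ in ∈-labels⁺ b≥1 b≤ s≥1 s≤

    total≡ : sum (map (usedAt ν) labels) ≡
             ∑ (1⋯ (bound H)) λ b → ∑ (1⋯ d) λ s → ∑ (0⋯ (K a r b s)) λ k → k * α a b * ν b s k
    total≡ = trans (∑-grid (1⋯ (bound H)) (1⋯ d) (usedAt ν))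
      (∑-cong (1⋯ (bound H)) λ b∈ → ∑-cong (1⋯ d) λ s∈ → used≡ (proj₁ (∈-1⋯⁻ b∈)) (fits (at b∈ s∈)))

    weight≡ : product (map (multiAt ν) labels) ≡ ∏ (1⋯ (bound H)) λ b → ∏ (1⋯ d) λ s → W H a r ν b s
    weight≡ = trans (∏-grid (1⋯ (bound H)) (1⋯ d) (multiAt ν))
      (∏-cong (1⋯ (bound H)) λ b∈ → ∏-cong (1⋯ d) λ s∈ → multi≡W (proj₁ (∈-1⋯⁻ b∈)) (fits (at b∈ s∈)))

    enc≡ : filter (λ (_ , _ , _ , c) → ¬? (c ≟ 0))
             (concatMap (λ b → concatMap (λ s → map (λ k → b , s , k , ν b s k) (0⋯ (K a r b s))) (1⋯ d)) (1⋯ (bound H)))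
           ≡ enc labels ν
    enc≡ = trans (filter-concatMap _ _ (1⋯ (bound H))) (trans
      (concatMap-cong-∈ (1⋯ (bound H)) λ b∈ → trans (filter-concatMap _ _ (1⋯ d))
        (concatMap-cong-∈ (1⋯ d) λ s∈ → items≡ (proj₁ (∈-1⋯⁻ b∈)) (fits (at b∈ s∈))))
      (sym (concatMap-grid (1⋯ (bound H)) (1⋯ d) (λ (b , s) → items b s (ν b s)))))

  𝒯 : Set
  𝒯 = Transition H a r

  open Transition

  code : 𝒯 → ⟦ PartialTy ⟧
  code τ = encodeTransition H a r τ , weight H a r τ

  module _ (τ : 𝒯) where
    open 𝒜 (ν∈𝒜 τ)

    fits : ∀ {b s} → (b , s) ∈ labels → Fits b s (ν τ b s)
    fits {b} {s} l∈ with ∈-labels⁻ l∈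
    ... | (b≥1 , _) , s≥1 , s≤d = record
      { rowsum = trans (sym (∑-extend (ν τ b s) (K≤d s b≥1) vanish)) (rows b s b≥1 s≥1 s≤d)
      ; beyond = vanish }
      where
      vanish : ∀ {k} → K a r b s < k → ν τ b s k ≡ 0
      vanish K<k = outside b s _ λ (_ , _ , _ , k≤K) → <⇒≱ K<k k≤K

    total′ : u τ + sum (map (usedAt (ν τ)) labels) ≡ r
    total′ = trans (cong (u τ +_) (total≡ fits)) total

    good : Good labels (ν τ)
    good = Good⁺ labels fits (≤-trans (m≤n+m _ (u τ)) (≤-reflexive total′))

    -- The equation `total` leaves no freedom for `u`: it is the residual budget after all rows.
    -- This is why the enumeration does not branch over `u`.
    code≡ : code τ ≡ result d a (res labels (ν τ))
    code≡ = cong₂ _,_ (cong₂ _,_ u≡ (trans (enc≡ fits) (sym (res-enc labels labels≥1 good))))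
      (cong₂ _*_ (cong (I a) u≡) (sym (trans (weight-res labels (ν τ)) (weight≡ fits))))
      where
      u≡ : u τ ≡ residual (res labels (ν τ))
      u≡ = trans (sym (m+n∸n≡m (u τ) (sum (map (usedAt (ν τ)) labels))))
        (trans (cong (_∸ sum (map (usedAt (ν τ)) labels)) total′) (sym (residual-res labels (ν τ))))

  h-beyond : ∀ {b s} → ¬ b ≤ bound H → h H a r b s ≡ 0
  h-beyond {b} {s} b≰ = go ((b ≟ a) ×-dec (s ≟ r))
    where
    entry≡0 = support H b s λ (_ , b≤ , _) → b≰ b≤
    go : ∀ {A : Set} (eq? : Dec A) → (if does eq? then entry H b s ∸ 1 else entry H b s) ≡ 0
    go (yes _) rewrite entry≡0 = refl
    go (no _)  = entry≡0

  realise : ∀ ν → Good labels ν → Off labels ν → ∃[ τ ] result d a (res labels ν) ≡ code τ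
  realise ν′ good′ off = τ , sym (code≡ τ)
    where
    fits′ = Good⇒Fits labels good′
    used≤r = Good⇒used≤ labels good′

    τ : 𝒯
    τ = record
      { u   = r ∸ sum (map (usedAt ν′) labels)
      ; u≤r = m∸n≤m r (sum (map (usedAt ν′) labels))
      ; ν   = ν′
      ; ν∈𝒜 = record
        { outside = out
        ; rows    = row
        ; total   = trans (cong (r ∸ sum (map (usedAt ν′) labels) +_) (sym (total≡ fits′))) (m∸n+n≡m used≤r)
        }
      }
      where
      out : ∀ b s k → ¬ (1 ≤ b × 1 ≤ s × s ≤ d × k ≤ K a r b s) → ν′ b s k ≡ 0
      out b s k ¬in with label? (b , s)
      ... | no  l∉ = off l∉ k
      ... | yes l∈ with ∈-labels⁻ l∈ | k ≤? K a r b s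
      ...   | (b≥1 , _) , s≥1 , s≤d | yes k≤K = contradiction (b≥1 , s≥1 , s≤d , k≤K) ¬in
      ...   | _                     | no  k≰K = beyond (fits′ l∈) (≰⇒> k≰K)

      row : ∀ b s → 1 ≤ b → 1 ≤ s → s ≤ d → ∑ (0⋯ (K a r b s)) (ν′ b s) ≡ h H a r b s
      row b s b≥1 s≥1 s≤d with b ≤? bound H
      ... | yes b≤ = rowsum-K b≥1 (fits′ (∈-labels⁺ b≥1 b≤ s≥1 s≤d))
      ... | no  b≰ = trans (trans (∑-cong (0⋯ (K a r b s)) {g = λ _ → 0} λ {k} _ → off l∉ k) (∑0 (0⋯ (K a r b s)) λ _ → refl))
                           (sym (h-beyond b≰))
        where
        l∉ : (b , s) ∉ labels
        l∉ l∈ = b≰ (proj₂ (proj₁ (∈-labels⁻ l∈)))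

  code-cong : ∀ {τ σ : 𝒯} → u τ ≡ u σ × (∀ b s k → ν τ b s k ≡ ν σ b s k) → code τ ≡ code σ
  code-cong {τ} {σ} (_ , ν≡) = trans (code≡ τ)
    (trans (cong (result d a) (res-cong labels λ {b} {s} _ {k} _ → ν≡ b s k)) (sym (code≡ σ)))

  code-injective : ∀ {τ σ : 𝒯} → code τ ≡ code σ → u τ ≡ u σ × (∀ b s k → ν τ b s k ≡ ν σ b s k)
  code-injective {τ} {σ} eq = cong (proj₁ ∘ proj₁) eq , agree
    where
    on-labels : AgreeOn labels (ν τ) (ν σ)
    on-labels = enc-injective labels
      (trans (sym (enc≡ (fits τ))) (trans (cong (proj₂ ∘ proj₁) eq) (enc≡ (fits σ))))

    agree : ∀ b s k → ν τ b s k ≡ ν σ b s k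
    agree b s k with (1 ≤? b) ×-dec (1 ≤? s) ×-dec (s ≤? d) ×-dec (k ≤? K a r b s)
    ... | no ¬in = trans (𝒜.outside (ν∈𝒜 τ) b s k ¬in) (sym (𝒜.outside (ν∈𝒜 σ) b s k ¬in))
    ... | yes (b≥1 , s≥1 , s≤d , k≤K) with b ≤? bound H
    ...   | yes b≤ = on-labels (∈-labels⁺ b≥1 b≤ s≥1 s≤d) (≤-trans k≤K (K≤d s b≥1))
    -- The code does not show rows past `bound H`; there `h` is 0, and the row sums force both
    -- families to vanish.
    ...   | no  b≰ = trans (absent τ) (sym (absent σ))
      where
      absent : ∀ τ → ν τ b s k ≡ 0
      absent τ = ∑≡0⇒≡0 (0⋯ (K a r b s)) (ν τ b s)
        (trans (𝒜.rows (ν∈𝒜 τ) b s b≥1 s≥1 s≤d) (h-beyond b≰)) (∈-upTo⁺ (s≤s k≤K))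

  L-sound : ∀ {p} → p ∈ L → ∃[ ν ] Good labels ν × Off labels ν × p ≡ res labels ν
  L-sound p∈ = enumerate-sound labels labels-unique labels≥1 (subst (_ ∈_) L≡ p∈)

  out : ⟦ OutputTy ⟧
  out = generate (encodeState H , a , r)

  out≡ : out ≡ map (result d a) L
  out≡ = concatMap-[-] L λ {p} p∈ → let ν , _ , _ , p≡ = L-sound p∈ in
    finish≡ d a p (subst (λ q → residual q ≤ d) (sym p≡) (residual-res≤d labels ν))

  out-unique : Unique out
  out-unique = subst Unique (sym out≡) (map-unique (result d a) L
    (subst Unique (sym L≡) (enumerate-unique labels labels-unique labels≥1)) injective)
    where
    injective : ∀ {p q} → p ∈ L → q ∈ L → result d a p ≡ result d a q → p ≡ q
    injective p∈ q∈ eq with L-sound p∈ | L-sound q∈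
    ... | ν , good , _ , refl | ν′ , good′ , _ , refl = res-cong labels (enc-injective labels
      (trans (sym (res-enc labels labels≥1 good)) (trans (cong (proj₂ ∘ proj₁) eq) (res-enc labels labels≥1 good′))))

  out-codes : ∀ x → x ∈ out ⇔ (∃[ τ ] x ≡ code τ)
  out-codes x = mk⇔ sound λ { (τ , refl) → complete τ }
    where
    sound : x ∈ out → ∃[ τ ] x ≡ code τ
    sound x∈ with ∈-map⁻ (result d a) (subst (x ∈_) out≡ x∈)
    ... | p , p∈ , refl with L-sound p∈
    ...   | ν , good , off , refl = realise ν good off

    complete : ∀ τ → code τ ∈ out
    complete τ = subst (code τ ∈_) (sym out≡) (subst (_∈ map (result d a) L) (sym (code≡ τ))
      (∈-map⁺ (result d a) (subst (res labels (ν τ) ∈_) (sym L≡) (enumerate-complete labels labels≥1 (ν τ) (good τ)))))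

  cardinality : HasCardinality (transitions H a r) (length out)
  cardinality = codes⇒cardinality (transitions H a r) code out (λ {τ} {σ} → code-cong {τ} {σ}) (λ {τ} {σ} → code-injective {τ} {σ}) out-unique out-codes

  -- Witness: u = r and ν supported on k = 0.
  out-nonempty : 1 ≤ length out
  out-nonempty = nonempty (Equivalence.from (out-codes _) (realise ν₀ good₀ off₀ .proj₁ , refl))
    where
    nonempty : ∀ {X : Set} {x : X} {xs} → x ∈ xs → 1 ≤ length xs
    nonempty (here _)  = s≤s z≤n
    nonempty (there _) = s≤s z≤n

    ν₀ : Family
    ν₀ b s zero    = pick (label? (b , s)) (h H a r b s) 0
    ν₀ b s (suc k) = 0

    fits₀ : ∀ {b s} → (b , s) ∈ labels → Fits b s (ν₀ b s)
    fits₀ {b} {s} l∈ = record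
      { rowsum = trans (∑0⋯ (ν₀ b s)) (trans (cong₂ _+_ (pick-yes (label? (b , s)) l∈)
          (trans (∑-cong (1⋯ d) {ν₀ b s} {λ _ → 0} (on1⋯ {ν₀ b s} {λ _ → 0} λ _ → refl)) (∑0 (1⋯ d) λ _ → refl)))
          (+-identityʳ (h H a r b s)))
      ; beyond = λ { {suc k} _ → refl } }

    used₀ : ∀ ls → sum (map (usedAt ν₀) ls) ≡ 0
    used₀ []             = refl
    used₀ ((b , s) ∷ ls) = cong₂ _+_ (trans (used-cong (rowOf (b , s)) {ν₀ b s} {λ _ → 0} λ _ → refl)
      (trans (cong (Row.α′ a r (rowOf (b , s)) *_) (∑0 (1⋯ d) λ k → *-zeroʳ k)) (*-zeroʳ (Row.α′ a r (rowOf (b , s)))))) (used₀ ls)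

    good₀ : Good labels ν₀
    good₀ = Good⁺ labels fits₀ (≤-trans (≤-reflexive (used₀ labels)) z≤n)

    off₀ : Off labels ν₀
    off₀ {b} {s} l∉ zero = pick-no (label? (b , s)) l∉
    off₀ l∉ (suc k)      = refl

  -- Bounds in terms of the number of active vertices

  E : ⟦ StateTy ⟧
  E = encodeState H

  N≡ : N H ≡ sum (map (λ l → proj₁ l * entry H (proj₁ l) (proj₂ l)) labels)
  N≡ = sym (∑-grid (1⋯ (bound H)) (1⋯ d) λ (b , s) → b * entry H b s)

  -- A stored entry (b, s, c) has b, c ≥ 1, so each of 1, b and c is at most bc, and s is at most d
  -- times bc; whence 3 + d. The arbitrary `bound H` does not enter, as zero entries are not stored.
  size-E≤ : size StateTy E ≤ (3 + d) * N H
  size-E≤ = ≤-trans (≤-reflexive (cong (size StateTy) encodeState≡))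
    (≤-trans (go labels λ l∈ → l∈) (≤-reflexive (cong ((3 + d) *_) (sym N≡))))
    where
    row≤ : ∀ b s c → 1 ≤ b → s ≤ d → suc (b + (s + suc c)) ≤ (3 + d) * (b * suc c)
    row≤ b s c b≥1 s≤d = begin
      1 + (b + (s + suc c))            ≤⟨ +-mono-≤ bc≥1 (+-mono-≤ (m≤m*n b (suc c)) (+-mono-≤ (≤-trans s≤d (m≤m*n d (b * suc c) ⦃ >-nonZero bc≥1 ⦄)) (m≤n*m (suc c) b ⦃ >-nonZero b≥1 ⦄))) ⟩
      x + (x + (d * x + x))            ≡⟨ shuffle d x ⟩
      (3 + d) * x                      ∎
      where
      open ≤-Reasoning
      open +-*-Solver using (solve; _:*_; _:+_; con; _:=_)
      x = b * suc c
      bc≥1 : 1 ≤ x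
      bc≥1 = *-mono-≤ b≥1 (s≤s (z≤n {c}))
      shuffle : ∀ d x → x + (x + (d * x + x)) ≡ (3 + d) * x
      shuffle = solve 2 (λ d x → x :+ (x :+ (d :* x :+ x)) := (con 3 :+ d) :* x) refl

    go : ∀ ls → (∀ {l} → l ∈ ls → l ∈ labels) →
         size StateTy (filter (nonzero? d) (map rowOf ls)) ≤ (3 + d) * sum (map (λ l → proj₁ l * entry H (proj₁ l) (proj₂ l)) ls)
    go []             _   = z≤n
    go ((b , s) ∷ ls) ls⊆ with entry H b s
    ... | zero  rewrite *-zeroʳ b = go ls (ls⊆ ∘ there)
    ... | suc c = ≤-trans (+-mono-≤ (row≤ b s c (proj₁ (proj₁ (∈-labels⁻ (ls⊆ (here refl))))) (proj₂ (proj₂ (∈-labels⁻ (ls⊆ (here refl))))))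
                                    (go ls (ls⊆ ∘ there)))
                          (≤-reflexive (sym (*-distribˡ-+ (3 + d) (b * suc c) _)))

  a≤N : a ≤ N H
  a≤N = ≤-trans (m≤m*n a (entry H a r) ⦃ >-nonZero pivot ⦄)
    (≤-trans (≤sum (λ l → proj₁ l * entry H (proj₁ l) (proj₂ l)) labels
      (∈-labels⁺ a≥1 (proj₁ (proj₂ range)) (proj₁ (proj₂ (proj₂ range))) r≤d)) (≤-reflexive (sym N≡)))

  module _ {n : ℕ} (N≤n : N H ≤ n) where
    private
      n≥1 : 1 ≤ n
      n≥1 = ≤-trans a≥1 (≤-trans a≤N N≤n)

    -- The left side is the base of the powers in `≼`. Since n ≥ 1, the summands are at most 2n for
    -- the 2, (3 + d)n for the state, n for `a` and dn for `r`.
    size-input≤ : 2 + size InputTy (E , a , r) ≤ (6 + 2 * d) * n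
    size-input≤ = begin
      2 + (size StateTy E + (a + r))            ≤⟨ +-mono-≤ (*-monoʳ-≤ 2 n≥1) (+-mono-≤ (≤-trans size-E≤ (*-monoʳ-≤ (3 + d) N≤n))
                                                    (+-mono-≤ (≤-trans a≤N N≤n) (≤-trans r≤d (m≤m*n d n ⦃ >-nonZero n≥1 ⦄)))) ⟩
      2 * n + ((3 + d) * n + (n + d * n))       ≡⟨ shuffle d n ⟩
      (6 + 2 * d) * n                           ∎
      where
      open ≤-Reasoning
      open +-*-Solver using (solve; _:*_; _:+_; con; _:=_)
      shuffle : ∀ d n → 2 * n + ((3 + d) * n + (n + d * n)) ≡ (6 + 2 * d) * n
      shuffle = solve 2 (λ d n → con 2 :* n :+ ((con 3 :+ d) :* n :+ (n :+ d :* n)) := (con 6 :+ con 2 :* d) :* n) refl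

    -- The exponent is the budget bound `d`. The base is linear in `n`, because the state has at
    -- most (3 + d)n stored entries and the summand 1 is at most `n`.
    length-out≤ : length out ≤ (1 + (3 + d) * branching) ^ d * n ^ d
    length-out≤ = begin
      length out                                ≡⟨ trans (cong length out≡) (length-map (result d a) L) ⟩
      length L                                  ≤⟨ length-enumerate a r E ⟩
      (1 + length E * branching) ^ d            ≤⟨ ^-monoˡ-≤ d (+-mono-≤ n≥1 (*-monoˡ-≤ branching
                                                     (≤-trans (length≤size RowTy E) (≤-trans size-E≤ (*-monoʳ-≤ (3 + d) N≤n))))) ⟩
      (n + (3 + d) * n * branching) ^ d         ≡⟨ cong (_^ d) (shuffle n (3 + d) branching) ⟩
      ((1 + (3 + d) * branching) * n) ^ d       ≡⟨ ^-distribʳ-* d (1 + (3 + d) * branching) n ⟩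
      (1 + (3 + d) * branching) ^ d * n ^ d     ∎
      where
      open ≤-Reasoning
      open +-*-Solver using (solve; _:*_; _:+_; con; _:=_)
      shuffle : ∀ n x y → n + x * n * y ≡ (1 + x * y) * n
      shuffle = solve 3 (λ n x y → n :+ x :* n :* y := (con 1 :+ x :* y) :* n) refl

-- Stated for a variable program, so that the exponents of the concrete one are
-- never unfolded.
bounds⇒lemma : ∀ d → FP InputTy OutputTy (Enumeration.generate d) →
    ∃[ C ] Σ (Program InputTy OutputTy) λ gen → ∃[ D ] ∃[ e ]
    (∀ (n : ℕ) (H : State d) → Nonzero H → N H ≤ n →
    ∀ (a r : ℕ) → 0 < entry H a r →
    ∃[ m ] HasCardinality (transitions H a r) m
    × m ≤ C * n ^ d
    × Generates H a r (run gen (encodeState H , a , r))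
    × time gen (encodeState H , a , r) ≤ m * (D * n ^ e))
bounds⇒lemma d gen = (1 + (3 + d) * branching) ^ d , prog gen , (6 + 2 * d) ^ c , c , main
  where
  open Enumeration d using (branching)

  c : ℕ
  c = proj₁ (time≼ gen)

  main : ∀ (n : ℕ) (H : State d) → Nonzero H → N H ≤ n → ∀ (a r : ℕ) → 0 < entry H a r →
    ∃[ m ] HasCardinality (transitions H a r) m
    × m ≤ (1 + (3 + d) * branching) ^ d * n ^ d
    × Generates H a r (run (prog gen) (encodeState H , a , r))
    × time (prog gen) (encodeState H , a , r) ≤ m * ((6 + 2 * d) ^ c * n ^ c)
  main n H _ N≤n a r pivot = length out , cardinality , length-out≤ N≤n
    , subst (Generates H a r) (sym (correct gen input)) (out-unique , out-codes)
    , (begin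
      time (prog gen) input                        ≤⟨ proj₂ (time≼ gen) input ⟩
      (2 + size InputTy input) ^ c                 ≤⟨ ^-monoˡ-≤ c (size-input≤ N≤n) ⟩
      ((6 + 2 * d) * n) ^ c                        ≡⟨ ^-distribʳ-* c (6 + 2 * d) n ⟩
      (6 + 2 * d) ^ c * n ^ c                      ≤⟨ m≤n*m _ (length out) ⦃ >-nonZero out-nonempty ⦄ ⟩
      length out * ((6 + 2 * d) ^ c * n ^ c)       ∎)
    where
    open ≤-Reasoning
    open Bijection H a r pivot
    input : ⟦ InputTy ⟧
    input = encodeState H , a , r

lemma5p2 : ∀ (d : ℕ) → 1 ≤ d →
    ∃[ C ] Σ (Program InputTy OutputTy) λ gen → ∃[ D ] ∃[ e ]
    (∀ (n : ℕ) (H : State d) → Nonzero H → N H ≤ n →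
    ∀ (a r : ℕ) → 0 < entry H a r →
    ∃[ m ] HasCardinality (transitions H a r) m
    × m ≤ C * n ^ d
    × Generates H a r (run gen (encodeState H , a , r))
    × time gen (encodeState H , a , r) ≤ m * (D * n ^ e))
lemma5p2 d _ = bounds⇒lemma d (generateᶠ d)
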